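{- Let $m,u\ge 2$, $p\ge 1$ and $n,v\ge 0$ be integers. For integers $N,M,j\ge 0$ let $\mathcal{A}_p(N,M,j)$ denote the set of all $N$-tuples $(a_1,\dots,a_N)$ of positive integer multiples of $p$ with $a_1+\dots+a_N=Mp$ and such that exactly $j$ of the entries $a_s$ are even multiples of $p$ (i.e. of the form $rp$ with $r$ even). Then $$ \begin{aligned} &\zeta^t(m,\{p\}^n)\,\zeta^t(u,\{p\}^v)\\ ={}&\sum_{l=1}^{n}\ \sum_{k=0}^{\min\{v,n-l\}}\ \sum_{\substack{i+j=k\\ i,j\ge 0}}\ \sum_{(a_1,\dots,a_N)\in\mathcal{A}_p(N,\,n+v-l,\,j)} \binom{v+n-l-2k}{v-k}(t^2-t)^i(1-2t)^j\\ &\quad\times\Big[\zeta^t(m,\{p\}^l,u,a_1,\dots,a_N)+(1-2t)\zeta^t(m,\{p\}^{l-1},u+p,a_1,\dots,a_N)\\ &\qquad\ +(1-\delta_{v,0}\delta_{n,l})(t^2-t)\zeta^t(m,\{p\}^{l-1},u+p+a_1,a_2,\dots,a_N)\Big]\\ &+\sum_{l=1}^{v}\ \sum_{k=0}^{\min\{n,v-l\}}\ \sum_{\substack{i+j=k\\ i,j\ge 0}}\ \sum_{(a_1,\dots,a_N)\in\mathcal{A}_p(N,\,n+v-l,\,j)} \binom{v+n-l-2k}{n-k}(t^2-t)^i(1-2t)^j\\ &\quad\times\Big[\zeta^t(u,\{p\}^l,m,a_1,\dots,a_N)+(1-2t)\zeta^t(u,\{p\}^{l-1},m+p,a_1,\dots,a_N)\\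 &\qquad\ +(1-\delta_{n,0}\delta_{v,l})(t^2-t)\zeta^t(u,\{p\}^{l-1},m+p+a_1,a_2,\dots,a_N)\Big]\\ &+\sum_{k=0}^{\min\{n,v\}}\ \sum_{\substack{i+j=k\\ i,j\ge 0}}\ \sum_{(a_1,\dots,a_{N'})\in\mathcal{A}_p(N',\,n+v,\,j)} \binom{v+n-2k}{n-k}(t^2-t)^i(1-2t)^j\\ &\quad\times\Big[\zeta^t(m,u,a_1,\dots,a_{N'})+\zeta^t(u,m,a_1,\dots,a_{N'})+(1-2t)\zeta^t(m+u,a_1,\dots,a_{N'})\\ &\qquad\ +(1-\delta_{n,0}\delta_{v,0})(t^2-t)\zeta^t(m+u+a_1,a_2,\dots,a_{N'})\Big], \end{aligned} $$ where $N=v+n-l-i-k$ in the first two sums and $N'=v+n-i-k$ in the third.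
   Context: For positive integers $k_1,\dots,k_n$ with $k_1\ge 2$ (an admissible index), the multiple zeta value is $\zeta(k_1,\dots,k_n)=\sum_{m_1>\cdots>m_n\ge 1}\frac{1}{m_1^{k_1}\cdots m_n^{k_n}}$, and the interpolated multiple zeta value is the polynomial $$\zeta^t(k_1,\dots,k_n)=\sum_{\mathbf p}t^{\,n-\mathrm{dep}(\mathbf p)}\zeta(\mathbf p)\in\mathbb{R}[t],$$ where $\mathbf p$ runs over the $2^{n-1}$ indices $(k_1\Box k_2\Box\cdots\Box k_n)$ obtained by replacing each $\Box$ by either a comma or a plus sign, and $\mathrm{dep}(\mathbf p)$ is the number of entries of $\mathbf p$. $\{p\}^l$ denotes $p$ repeated $l$ times (omitted if $l=0$); $\delta_{i,j}$ is Kronecker's delta. Empty sums are $0$; $\mathcal{A}_p(0,0,0)$ consists of the empty tuple and $\mathcal{A}_p(0,M,j)$ is empty for $(M,j)\ne(0,0)$. A term involving $a_1$ when there is no $a_1$ (empty tuple) occurs only with coefficient $1-\delta\delta=0$ and is read as $0$. -}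

module Defs where

open import Level using (Level; 0ℓ)
open import Function.Bundles using (_⇔_; mk⇔)
open import Data.Bool.Base using (if_then_else_)
open import Data.Empty using (⊥-elim)
open import Data.Sum.Base using ([_,_]′)
open import Data.Product.Base using (∃; _×_; _,_)
open import Data.Nat.Base as ℕ using (ℕ; zero; suc; _∸_; z≤n; s≤s)
import Data.Nat.Properties as ℕ
open import Data.Nat.Divisibility using (_∣_; _∣?_; divides)
open import Data.Nat.ListAction using (sum)
open import Data.Integer.Base as ℤ using (+_)
import Data.Integer.Properties as ℤ
open import Data.List.Base
  using (List; []; _∷_; _++_; map; length; foldr; filter; applyUpTo; cartesianProductWith)
import Data.List.Properties as List
open import Data.List.Relation.Unary.All as All using (All; []; _∷_)
open import Data.List.Relation.Unary.Any using (here)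
open import Data.List.Relation.Unary.AllPairs using ([]; _∷_)
open import Data.List.Relation.Unary.Unique.Propositional using (Unique)
import Data.List.Relation.Unary.Unique.Propositional.Properties as Unique
open import Data.List.Membership.Propositional using (_∈_)
import Data.List.Membership.Propositional.Properties as ∈
open import Data.Rational.Base as ℚ using (ℚ; 0ℚ; 1ℚ; ½; mkℚ)
import Data.Rational.Properties as ℚ
import Data.Rational.Unnormalised.Base as ℚᵘ
import Data.Rational.Unnormalised.Properties as ℚᵘ
open import Data.Nat.Tactic.RingSolver using () renaming (solve-∀ to ℕ-solve-∀)
open import Tactic.RingSolver using (solve-∀)
open import Tactic.RingSolver.Core.AlmostCommutativeRing
  using (AlmostCommutativeRing; fromCommutativeRing)
open import Relation.Binary.PropositionalEquality
  using (_≡_; refl; sym; trans; cong; cong₂; subst; module ≡-Reasoning)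
open import Relation.Nullary.Decidable using (recompute; dec⇒maybe; _×-dec_)
open import Algebra.Bundles.Raw using (RawRing)
import Algebra.Definitions.RawMonoid as RawMonoid
import Algebra.Definitions.RawSemiring as RawSemiring

Cauchy : (ℕ → ℚ) → Set
Cauchy x = ∀ ε → 0ℚ ℚ.< ε →
  ∃ λ N → ∀ m n → N ℕ.≤ m → N ℕ.≤ n → ℚ.∣ x m ℚ.- x n ∣ ℚ.< ε

-- ∃ is constructive, so a real number carries a modulus of convergence.
record ℝ : Set where
  constructor mkℝ
  field
    seq    : ℕ → ℚ
    cauchy : Cauchy seq

open ℝ public

infix 4 _≈ℝ_
_≈ℝ_ : ℝ → ℝ → Set
x ≈ℝ y = ∀ ε → 0ℚ ℚ.< ε →
  ∃ λ N → ∀ n → N ℕ.≤ n → ℚ.∣ seq x n ℚ.- seq y n ∣ ℚ.< ε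

1/[_] : (n : ℕ) .{{_ : ℕ.NonZero n}} → ℚ
1/[ n ] = + 1 ℚ./ n

private
  ℚ-ring : AlmostCommutativeRing 0ℓ 0ℓ
  ℚ-ring = fromCommutativeRing ℚ.+-*-commutativeRing (λ x → dec⇒maybe (0ℚ ℚ.≟ x))

  neg-sub : ∀ a b → ℚ.- (a ℚ.- b) ≡ (ℚ.- a) ℚ.- (ℚ.- b)
  neg-sub = solve-∀ ℚ-ring

  sub-add : ∀ a b → (a ℚ.- b) ℚ.+ b ≡ a
  sub-add = solve-∀ ℚ-ring

  add-sub : ∀ a b c d → (a ℚ.- b) ℚ.+ (c ℚ.- d) ≡ (a ℚ.+ c) ℚ.- (b ℚ.+ d)
  add-sub = solve-∀ ℚ-ring

  mul-sub : ∀ a b c d → a ℚ.* (c ℚ.- d) ℚ.+ (a ℚ.- b) ℚ.* d ≡ a ℚ.* c ℚ.- b ℚ.* d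
  mul-sub = solve-∀ ℚ-ring

  swap : ∀ a b c → a ℚ.* (b ℚ.* c) ≡ b ℚ.* (a ℚ.* c)
  swap = solve-∀ ℚ-ring

  distrib : ∀ b c d → b ℚ.* d ℚ.+ d ℚ.* c ≡ (b ℚ.+ c) ℚ.* d
  distrib = solve-∀ ℚ-ring

  0<1 : 0ℚ ℚ.< 1ℚ
  0<1 = ℚ.positive⁻¹ 1ℚ

  0<½ : 0ℚ ℚ.< ½
  0<½ = ℚ.positive⁻¹ ½

  *-pos : ∀ {p q} → 0ℚ ℚ.< p → 0ℚ ℚ.< q → 0ℚ ℚ.< p ℚ.* q
  *-pos {p} {q} 0<p 0<q =
    ℚ.positive⁻¹ _ {{ℚ.pos*pos⇒pos p {{ℚ.positive 0<p}} q {{ℚ.positive 0<q}}}}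

  *-nonNeg : ∀ {p q} → 0ℚ ℚ.≤ p → 0ℚ ℚ.≤ q → 0ℚ ℚ.≤ p ℚ.* q
  *-nonNeg {p} {q} 0≤p 0≤q = ℚ.nonNegative⁻¹ _
    {{ℚ.nonNeg*nonNeg⇒nonNeg p {{ℚ.nonNegative 0≤p}} q {{ℚ.nonNegative 0≤q}}}}

  +-nonNeg : ∀ {p q} → 0ℚ ℚ.≤ p → 0ℚ ℚ.≤ q → 0ℚ ℚ.≤ p ℚ.+ q
  +-nonNeg = ℚ.+-mono-≤

  *-mono-≤ : ∀ {p q r s} → 0ℚ ℚ.≤ q → 0ℚ ℚ.≤ r →
             p ℚ.≤ q → r ℚ.≤ s → p ℚ.* r ℚ.≤ q ℚ.* s
  *-mono-≤ {p} {q} {r} {s} 0≤q 0≤r p≤q r≤s = ℚ.≤-trans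
    (ℚ.*-monoʳ-≤-nonNeg r {{ℚ.nonNegative 0≤r}} p≤q)
    (ℚ.*-monoˡ-≤-nonNeg q {{ℚ.nonNegative 0≤q}} r≤s)

  ≤-from-diff : ∀ {p q} d → 0ℚ ℚ.≤ d → q ≡ p ℚ.+ d → p ℚ.≤ q
  ≤-from-diff {p} d 0≤d refl = subst (ℚ._≤ p ℚ.+ d) (ℚ.+-identityʳ p) (ℚ.+-monoʳ-≤ p 0≤d)

  ε/2+ε/2 : ∀ ε → ½ ℚ.* ε ℚ.+ ½ ℚ.* ε ≡ ε
  ε/2+ε/2 ε = trans (sym (ℚ.*-distribʳ-+ ε ½ ½)) (ℚ.*-identityˡ ε)

  abstract
    cauchy-const : ∀ q → Cauchy (λ _ → q)
    cauchy-const q ε 0<ε =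
      0 , λ _ _ _ _ → subst (λ d → ℚ.∣ d ∣ ℚ.< ε) (sym (ℚ.+-inverseʳ q)) 0<ε

  abstract
    cauchy-neg : ∀ x → Cauchy x → Cauchy (λ n → ℚ.- x n)
    cauchy-neg x cx ε 0<ε with cx ε 0<ε
    ... | N , h = N , λ m n N≤m N≤n → subst (ℚ._< ε) (eq m n) (h m n N≤m N≤n)
      where
      eq : ∀ m n → ℚ.∣ x m ℚ.- x n ∣ ≡ ℚ.∣ ℚ.- x m ℚ.- ℚ.- x n ∣
      eq m n = trans (sym (ℚ.∣-p∣≡∣p∣ (x m ℚ.- x n))) (cong ℚ.∣_∣
        (neg-sub (x m) (x n)))

  abstract
    cauchy-+ : ∀ x y → Cauchy x → Cauchy y → Cauchy (λ n → x n ℚ.+ y n)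
    cauchy-+ x y cx cy ε 0<ε
      with cx (½ ℚ.* ε) (*-pos 0<½ 0<ε) | cy (½ ℚ.* ε) (*-pos 0<½ 0<ε)
    ... | N , h | N′ , h′ = N ℕ.⊔ N′ , λ m n le le′ →
      ℚ.≤-<-trans (subst (ℚ._≤ ℚ.∣ x m ℚ.- x n ∣ ℚ.+ ℚ.∣ y m ℚ.- y n ∣)
          (cong ℚ.∣_∣ (add-sub (x m) (x n) (y m) (y n)))
          (ℚ.∣p+q∣≤∣p∣+∣q∣ (x m ℚ.- x n) (y m ℚ.- y n)))
        (subst (ℚ.∣ x m ℚ.- x n ∣ ℚ.+ ℚ.∣ y m ℚ.- y n ∣ ℚ.<_) (ε/2+ε/2 ε)
          (ℚ.+-mono-< (h m n (ℕ.≤-trans (ℕ.m≤m⊔n N N′) le) (ℕ.≤-trans (ℕ.m≤m⊔n N N′) le′))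
            (h′ m n (ℕ.≤-trans (ℕ.m≤n⊔m N N′) le) (ℕ.≤-trans (ℕ.m≤n⊔m N N′) le′))))

  cauchy-bounded : ∀ x → Cauchy x →
    ∃ λ N → ∃ λ B → 0ℚ ℚ.< B × (∀ n → N ℕ.≤ n → ℚ.∣ x n ∣ ℚ.≤ B)
  cauchy-bounded x cx with cx 1ℚ 0<1
  ... | N , h = N , 1ℚ ℚ.+ ℚ.∣ x N ∣ , ℚ.+-mono-<-≤ 0<1 (ℚ.0≤∣p∣ (x N)) , λ n N≤n →
    ℚ.≤-trans (subst (λ d → ℚ.∣ d ∣ ℚ.≤ ℚ.∣ x n ℚ.- x N ∣ ℚ.+ ℚ.∣ x N ∣)
        (sub-add (x n) (x N))
        (ℚ.∣p+q∣≤∣p∣+∣q∣ (x n ℚ.- x N) (x N)))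
      (ℚ.+-monoˡ-≤ ℚ.∣ x N ∣ (ℚ.<⇒≤ (h n N N≤n ℕ.≤-refl)))

  *-perturb : ∀ x₁ x₂ y₁ y₂ {B C δ} → 0ℚ ℚ.< B → 0ℚ ℚ.< δ →
    ℚ.∣ x₁ ∣ ℚ.≤ B → ℚ.∣ y₂ ∣ ℚ.≤ C → ℚ.∣ x₁ ℚ.- x₂ ∣ ℚ.< δ → ℚ.∣ y₁ ℚ.- y₂ ∣ ℚ.< δ →
    ℚ.∣ x₁ ℚ.* y₁ ℚ.- x₂ ℚ.* y₂ ∣ ℚ.< B ℚ.* δ ℚ.+ δ ℚ.* C
  *-perturb x₁ x₂ y₁ y₂ {B} {C} {δ} 0<B 0<δ bx by hx hy = begin-strict
    ℚ.∣ x₁ ℚ.* y₁ ℚ.- x₂ ℚ.* y₂ ∣                          ≡⟨ cong ℚ.∣_∣ (mul-sub x₁ x₂ y₁ y₂) ⟨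
    ℚ.∣ x₁ ℚ.* dy ℚ.+ dx ℚ.* y₂ ∣                          ≤⟨ ℚ.∣p+q∣≤∣p∣+∣q∣ (x₁ ℚ.* dy) (dx ℚ.* y₂) ⟩
    ℚ.∣ x₁ ℚ.* dy ∣ ℚ.+ ℚ.∣ dx ℚ.* y₂ ∣
      ≡⟨ cong₂ ℚ._+_ (ℚ.∣p*q∣≡∣p∣*∣q∣ x₁ dy) (ℚ.∣p*q∣≡∣p∣*∣q∣ dx y₂) ⟩
    ℚ.∣ x₁ ∣ ℚ.* ℚ.∣ dy ∣ ℚ.+ ℚ.∣ dx ∣ ℚ.* ℚ.∣ y₂ ∣        <⟨ ℚ.+-mono-<-≤ b₁ b₂ ⟩
    B ℚ.* δ ℚ.+ δ ℚ.* C                                    ∎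
    where
    open ℚ.≤-Reasoning
    dx = x₁ ℚ.- x₂
    dy = y₁ ℚ.- y₂
    b₁ : ℚ.∣ x₁ ∣ ℚ.* ℚ.∣ dy ∣ ℚ.< B ℚ.* δ
    b₁ = ℚ.≤-<-trans
      (ℚ.*-monoʳ-≤-nonNeg ℚ.∣ dy ∣ {{ℚ.∣-∣-nonNeg dy}} bx)
      (ℚ.*-monoʳ-<-pos B {{ℚ.positive 0<B}} hy)
    b₂ : ℚ.∣ dx ∣ ℚ.* ℚ.∣ y₂ ∣ ℚ.≤ δ ℚ.* C
    b₂ = *-mono-≤ (ℚ.<⇒≤ 0<δ) (ℚ.0≤∣p∣ y₂) (ℚ.<⇒≤ hx) by

  div : ∀ ε K → 0ℚ ℚ.< ε → 0ℚ ℚ.< K → ∃ λ δ → 0ℚ ℚ.< δ × ε ≡ K ℚ.* δ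
  div ε K 0<ε 0<K =
    ε ℚ.* ℚ.1/ K , *-pos 0<ε (ℚ.positive⁻¹ (ℚ.1/ K) {{ℚ.1/pos⇒pos K}}) , sym (begin
      K ℚ.* (ε ℚ.* ℚ.1/ K) ≡⟨ swap K ε (ℚ.1/ K) ⟩
      ε ℚ.* (K ℚ.* ℚ.1/ K) ≡⟨ cong (ε ℚ.*_) (ℚ.*-inverseʳ K) ⟩
      ε ℚ.* 1ℚ             ≡⟨ ℚ.*-identityʳ ε ⟩
      ε                    ∎)
    where
    open ≡-Reasoning
    instance
      posK = ℚ.positive 0<K
      nonZeroK = ℚ.pos⇒nonZero K

  abstract
    cauchy-* : ∀ x y → Cauchy x → Cauchy y → Cauchy (λ n → x n ℚ.* y n)
    cauchy-* x y cx cy ε 0<ε =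
      let N₁ , B , 0<B , bx = cauchy-bounded x cx
          N₂ , C , 0<C , by = cauchy-bounded y cy
          δ , 0<δ , ε≡      = div ε (B ℚ.+ C) 0<ε (ℚ.+-mono-< 0<B 0<C)
          N₃ , hx           = cx δ 0<δ
          N₄ , hy           = cy δ 0<δ
      in (N₁ ℕ.⊔ N₂) ℕ.⊔ (N₃ ℕ.⊔ N₄) , λ m n N≤m N≤n →
        subst (ℚ.∣ x m ℚ.* y m ℚ.- x n ℚ.* y n ∣ ℚ.<_) (trans (distrib B C δ) (sym ε≡))
          (*-perturb (x m) (x n) (y m) (y n) {B} {C} {δ} 0<B 0<δ
            (bx m (≤₁ N₁ N₂ (≤₁ _ _ N≤m))) (by n (≤₂ N₁ N₂ (≤₁ _ _ N≤n)))
            (hx m n (≤₁ N₃ N₄ (≤₂ (N₁ ℕ.⊔ N₂) _ N≤m)) (≤₁ N₃ N₄ (≤₂ (N₁ ℕ.⊔ N₂) _ N≤n)))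
            (hy m n (≤₂ N₃ N₄ (≤₂ (N₁ ℕ.⊔ N₂) _ N≤m)) (≤₂ N₃ N₄ (≤₂ (N₁ ℕ.⊔ N₂) _ N≤n))))
      where
      ≤₁ : ∀ a b {k} → a ℕ.⊔ b ℕ.≤ k → a ℕ.≤ k
      ≤₁ a b = ℕ.m⊔n≤o⇒m≤o a b
      ≤₂ : ∀ a b {k} → a ℕ.⊔ b ℕ.≤ k → b ℕ.≤ k
      ≤₂ a b = ℕ.m⊔n≤o⇒n≤o a b

infix  8 -ℝ_
infixl 7 _*ℝ_
infixl 6 _+ℝ_

fromℚ : ℚ → ℝ
fromℚ q = mkℝ (λ _ → q) (cauchy-const q)

_+ℝ_ : ℝ → ℝ → ℝ
mkℝ x cx +ℝ mkℝ y cy = mkℝ (λ n → x n ℚ.+ y n) (cauchy-+ x y cx cy)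

_*ℝ_ : ℝ → ℝ → ℝ
mkℝ x cx *ℝ mkℝ y cy = mkℝ (λ n → x n ℚ.* y n) (cauchy-* x y cx cy)

-ℝ_ : ℝ → ℝ
-ℝ mkℝ x cx = mkℝ (λ n → ℚ.- x n) (cauchy-neg x cx)

ℝ-rawRing : RawRing 0ℓ 0ℓ
ℝ-rawRing = record
  { Carrier = ℝ
  ; _≈_     = _≈ℝ_
  ; _+_     = _+ℝ_
  ; _*_     = _*ℝ_
  ; -_      = -ℝ_
  ; 0#      = fromℚ 0ℚ
  ; 1#      = fromℚ 1ℚ
  }

-- Lists of coefficients, constant term first. Trailing zeros are allowed, so
-- equality compares all coefficients.

module Polynomial {c ℓ : Level} (R : RawRing c ℓ) where
  private module R = RawRing R

  coeff : List R.Carrier → ℕ → R.Carrier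
  coeff []      _       = R.0#
  coeff (a ∷ f) zero    = a
  coeff (a ∷ f) (suc i) = coeff f i

  add : List R.Carrier → List R.Carrier → List R.Carrier
  add []      g       = g
  add (a ∷ f) []      = a ∷ f
  add (a ∷ f) (b ∷ g) = (a R.+ b) ∷ add f g

  mul : List R.Carrier → List R.Carrier → List R.Carrier
  mul []      g = []
  mul (a ∷ f) g = add (map (a R.*_) g) (R.0# ∷ mul f g)

  const : R.Carrier → List R.Carrier
  const a = a ∷ []

  X : List R.Carrier
  X = R.0# ∷ R.1# ∷ []

  rawRing : RawRing c ℓ
  rawRing = record
    { Carrier = List R.Carrier
    ; _≈_     = λ f g → ∀ i → coeff f i R.≈ coeff g i
    ; _+_     = add
    ; _*_     = mul
    ; -_      = map R.-_
    ; 0#      = []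
    ; 1#      = const R.1#
    }

open Polynomial ℝ-rawRing public using (const) renaming (rawRing to ℝ[t]; X to t)

open RawRing ℝ[t] public using () renaming
  (Carrier to Poly; _≈_ to _≈ₚ_; _+_ to _+ₚ_; _*_ to _*ₚ_; -_ to -ₚ_; 0# to 0ₚ; 1# to 1ₚ)

infixl 6 _-ₚ_
_-ₚ_ : Poly → Poly → Poly
f -ₚ g = f +ₚ (-ₚ g)

open RawMonoid (RawRing.+-rawMonoid ℝ[t]) public using () renaming (_×_ to _×ₚ_)
open RawSemiring (RawRing.rawSemiring ℝ[t]) public using () renaming (_^_ to _^ₚ_)

∑ : {A : Set} → List A → (A → Poly) → Poly
∑ xs f = foldr _+ₚ_ 0ₚ (map f xs)

δ : ℕ → ℕ → Poly
δ i j = if i ℕ.≡ᵇ j then 1ₚ else 0ₚ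

record ℕ≥ (b : ℕ) : Set where
  constructor mkℕ≥
  field
    value  : ℕ
    .bound : b ℕ.≤ value

open ℕ≥ public

ℕ⁺ : Set
ℕ⁺ = ℕ≥ 1

infixl 6 _+⁺_
_+⁺_ : ∀ {b c} → ℕ≥ b → ℕ≥ c → ℕ≥ b
mkℕ≥ x b≤x +⁺ mkℕ≥ y _ = mkℕ≥ (x ℕ.+ y) (ℕ.m≤n⇒m≤n+o y b≤x)

pos : ℕ≥ 2 → ℕ⁺
pos (mkℕ≥ x 2≤x) = mkℕ≥ x (ℕ.<⇒≤ 2≤x)

-- A nonempty index whose first entry is at least b: `Index 1` is the type of
-- all indices and `Index 2` that of admissible ones.
Index : ℕ → Set
Index b = ℕ≥ b × List ℕ⁺

dep : ∀ {b} → Index b → ℕ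
dep (_ , ks) = suc (length ks)

-- The 2^(n-1) indices k₁ □ k₂ □ ⋯ □ kₙ, where each □ is a comma or a plus.
merges : ∀ {b} → ℕ≥ b → List ℕ⁺ → List (Index b)
merges k₁ []        = (k₁ , []) ∷ []
merges k₁ (k₂ ∷ ks) = map (λ (l , ls) → k₁ , l ∷ ls) (merges k₂ ks) ++ merges (k₁ +⁺ k₂) ks

1/_^_ : (m k : ℕ) .{{_ : ℕ.NonZero m}} → ℚ
1/ m ^ k = 1/[ m ℕ.^ k ] {{ℕ.m^n≢0 m k}}

-- ζ≤ M (k₁ ∷ ⋯ ∷ kₙ ∷ []) is the sum of 1 / (m₁^k₁ ⋯ mₙ^kₙ) over
-- M ≥ m₁ > ⋯ > mₙ ≥ 1; the last equation separates m₁ ≤ M from m₁ = M + 1.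
ζ≤ : ℕ → List ℕ⁺ → ℚ
ζ≤ M       []       = 1ℚ
ζ≤ zero    (k ∷ ks) = 0ℚ
ζ≤ (suc M) (k ∷ ks) = ζ≤ M (k ∷ ks) ℚ.+ 1/ suc M ^ value k ℚ.* ζ≤ M ks

private
  -- Convergence is proved with P M = ∏_{m ≤ M} (1 + 1/2m): truncated sums are
  -- bounded by a multiple of P M, the tail of the series beyond M by a multiple
  -- of P M / M, and P M ² / M is decreasing.

  h : ℕ → ℚ
  h M = ½ ℚ.* 1/[ suc M ]

  P : ℕ → ℚ
  P zero    = 1ℚ
  P (suc M) = P M ℚ.* (1ℚ ℚ.+ h M)

  2^ : ℕ → ℚ
  2^ zero    = 1ℚ
  2^ (suc d) = (1ℚ ℚ.+ 1ℚ) ℚ.* 2^ d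

  0≤1 : 0ℚ ℚ.≤ 1ℚ
  0≤1 = ℚ.<⇒≤ 0<1

  0<1/ : ∀ n .{{_ : ℕ.NonZero n}} → 0ℚ ℚ.< 1/[ n ]
  0<1/ n = ℚ.positive⁻¹ 1/[ n ] {{ℚ.normalize-pos 1 n}}

  0≤1/ : ∀ n .{{_ : ℕ.NonZero n}} → 0ℚ ℚ.≤ 1/[ n ]
  0≤1/ n = ℚ.<⇒≤ (0<1/ n)

  0<h : ∀ M → 0ℚ ℚ.< h M
  0<h M = *-pos 0<½ (0<1/ (suc M))

  h+h : ∀ M → h M ℚ.+ h M ≡ 1/[ suc M ]
  h+h M = ε/2+ε/2 1/[ suc M ]

  0<1+h : ∀ M → 0ℚ ℚ.< 1ℚ ℚ.+ h M
  0<1+h M = ℚ.+-mono-< 0<1 (0<h M)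

  0<P : ∀ M → 0ℚ ℚ.< P M
  0<P zero    = 0<1
  0<P (suc M) = *-pos (0<P M) (0<1+h M)

  1≤P : ∀ M → 1ℚ ℚ.≤ P M
  1≤P zero    = ℚ.≤-refl
  1≤P (suc M) = ℚ.≤-trans (1≤P M)
    (≤-from-diff (P M ℚ.* h M) (ℚ.<⇒≤ (*-pos (0<P M) (0<h M))) (expand (P M) (h M)))
    where
    expand : ∀ p k → p ℚ.* (1ℚ ℚ.+ k) ≡ p ℚ.+ p ℚ.* k
    expand = solve-∀ ℚ-ring

  0<2^ : ∀ d → 0ℚ ℚ.< 2^ d
  0<2^ zero    = 0<1
  0<2^ (suc d) = *-pos (ℚ.positive⁻¹ (1ℚ ℚ.+ 1ℚ)) (0<2^ d)

  1/-≃ : ∀ n → ℚ.toℚᵘ 1/[ suc n ] ℚᵘ.≃ ℚᵘ.mkℚᵘ (+ 1) n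
  1/-≃ n = ℚ.toℚᵘ-fromℚᵘ (ℚᵘ.mkℚᵘ (+ 1) n)

  1/-anti : ∀ m n .{{_ : ℕ.NonZero m}} .{{_ : ℕ.NonZero n}} →
            m ℕ.≤ n → 1/[ n ] ℚ.≤ 1/[ m ]
  1/-anti (suc m) (suc n) m≤n = ℚ.toℚᵘ-cancel-≤
    (ℚᵘ.≤-respˡ-≃ (ℚᵘ.≃-sym (1/-≃ n)) (ℚᵘ.≤-respʳ-≃ (ℚᵘ.≃-sym (1/-≃ m))
      (ℚᵘ.*≤* (ℤ.*-monoˡ-≤-nonNeg (+ 1) (ℤ.+≤+ m≤n)))))

  1/-* : ∀ m n .{{_ : ℕ.NonZero m}} .{{_ : ℕ.NonZero n}} →
         1/[ m ℕ.* n ] {{ℕ.m*n≢0 m n}} ≡ 1/[ m ] ℚ.* 1/[ n ]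
  1/-* (suc m) (suc n) = ℚ.toℚᵘ-injective (ℚᵘ.≃-trans (1/-≃ (n ℕ.+ m ℕ.* suc n))
    (ℚᵘ.≃-sym (ℚᵘ.≃-trans (ℚ.toℚᵘ-homo-* 1/[ suc m ] 1/[ suc n ])
      (ℚᵘ.*-cong (1/-≃ m) (1/-≃ n)))))

  1/-step : ∀ n → 1/[ suc n ] ≡ 1/[ 2 ℕ.+ n ] ℚ.+ 1/[ 2 ℕ.+ n ] ℚ.* 1/[ suc n ]
  1/-step n = ℚ.toℚᵘ-injective (ℚᵘ.≃-trans (1/-≃ n) (ℚᵘ.≃-trans lem (ℚᵘ.≃-sym
    (ℚᵘ.≃-trans (ℚ.toℚᵘ-homo-+ r (r ℚ.* s)) (ℚᵘ.+-cong (1/-≃ (suc n))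
      (ℚᵘ.≃-trans (ℚ.toℚᵘ-homo-* r s) (ℚᵘ.*-cong (1/-≃ (suc n)) (1/-≃ n))))))))
    where
    r = 1/[ 2 ℕ.+ n ]
    s = 1/[ suc n ]
    nat : ∀ n → 1 ℕ.* ((2 ℕ.+ n) ℕ.* ((2 ℕ.+ n) ℕ.* suc n)) ≡
                (1 ℕ.* ((2 ℕ.+ n) ℕ.* suc n) ℕ.+ 1 ℕ.* (2 ℕ.+ n)) ℕ.* suc n
    nat = ℕ-solve-∀
    lem : ℚᵘ.mkℚᵘ (+ 1) n ℚᵘ.≃
          ℚᵘ.mkℚᵘ (+ 1) (suc n) ℚᵘ.+ ℚᵘ.mkℚᵘ (+ 1) (suc n) ℚᵘ.* ℚᵘ.mkℚᵘ (+ 1) n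
    lem = ℚᵘ.*≡* (cong +_ (nat n))

  archimedean : ∀ δ → 0ℚ ℚ.< δ → ∃ λ n → 1/[ suc n ] ℚ.< δ
  archimedean δ@(mkℚ (+ suc a) d _)  0<δ = suc d , ℚ.toℚᵘ-cancel-<
    (ℚᵘ.<-respˡ-≃ (ℚᵘ.≃-sym (1/-≃ (suc d)))
      (ℚᵘ.*<* (ℤ.+<+ (ℕ.+-mono-<-≤ {suc d} {2 ℕ.+ d} ℕ.≤-refl z≤n))))
  archimedean δ@(mkℚ (+ zero) _ _)     0<δ = ⊥-elim (ℤ.Positive.pos (ℚ.positive {δ} 0<δ))
  archimedean δ@(mkℚ (ℤ.-[1+ _ ]) _ _) 0<δ = ⊥-elim (ℤ.Positive.pos (ℚ.positive {δ} 0<δ))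

  1/^-anti : ∀ M {j k} → j ℕ.≤ k → 1/ suc M ^ k ℚ.≤ 1/ suc M ^ j
  1/^-anti M {j} {k} j≤k =
    1/-anti (suc M ℕ.^ j) (suc M ℕ.^ k) {{ℕ.m^n≢0 (suc M) j}} {{ℕ.m^n≢0 (suc M) k}}
      (ℕ.^-monoʳ-≤ (suc M) j≤k)

  1/^-pos : ∀ M k → 0ℚ ℚ.≤ 1/ suc M ^ k
  1/^-pos M k = 0≤1/ (suc M ℕ.^ k) {{ℕ.m^n≢0 (suc M) k}}

  bound-ℕ≥ : ∀ {b} (k : ℕ≥ b) → b ℕ.≤ value k
  bound-ℕ≥ {b} (mkℕ≥ x b≤x) = recompute (b ℕ.≤? x) b≤x

  1/^1 : ∀ M → 1/ suc M ^ 1 ≡ 1/[ suc M ]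
  1/^1 M = ℚ./-cong {+ 1} refl (ℕ.*-identityʳ (suc M))

  1/^2 : ∀ M → 1/ suc M ^ 2 ≡ 1/[ suc M ] ℚ.* 1/[ suc M ]
  1/^2 M = trans (1/-* (suc M) (suc M ℕ.^ 1) {{_}} {{ℕ.m^n≢0 (suc M) 1}})
                 (cong (1/[ suc M ] ℚ.*_) (1/^1 M))

  0≤ζ≤ : ∀ M ks → 0ℚ ℚ.≤ ζ≤ M ks
  0≤ζ≤ M       []       = 0≤1
  0≤ζ≤ zero    (k ∷ ks) = ℚ.≤-refl
  0≤ζ≤ (suc M) (k ∷ ks) =
    +-nonNeg (0≤ζ≤ M (k ∷ ks)) (*-nonNeg (1/^-pos M (value k)) (0≤ζ≤ M ks))

  ζ≤-bound : ∀ M ks → ζ≤ M ks ℚ.≤ 2^ (length ks) ℚ.* P M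
  ζ≤-bound M       []       = subst (1ℚ ℚ.≤_) (sym (ℚ.*-identityˡ (P M))) (1≤P M)
  ζ≤-bound zero    (k ∷ ks) =
    ℚ.<⇒≤ (*-pos (0<2^ (suc (length ks))) 0<1)
  ζ≤-bound (suc M) (k ∷ ks) = begin
    ζ≤ M (k ∷ ks) ℚ.+ 1/ suc M ^ value k ℚ.* ζ≤ M ks
      ≤⟨ ℚ.+-mono-≤ (ζ≤-bound M (k ∷ ks))
           (*-mono-≤ (0≤1/ (suc M)) (0≤ζ≤ M ks) w≤ (ζ≤-bound M ks)) ⟩
    2D ℚ.* P M ℚ.+ 1/[ suc M ] ℚ.* (D ℚ.* P M)
      ≡⟨ cong (λ r → 2D ℚ.* P M ℚ.+ r ℚ.* (D ℚ.* P M)) (h+h M) ⟨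
    2D ℚ.* P M ℚ.+ (h M ℚ.+ h M) ℚ.* (D ℚ.* P M)
      ≡⟨ identity D (P M) (h M) ⟩
    2D ℚ.* (P M ℚ.* (1ℚ ℚ.+ h M)) ∎
    where
    open ℚ.≤-Reasoning
    D = 2^ (length ks)
    2D = (1ℚ ℚ.+ 1ℚ) ℚ.* D
    w≤ : 1/ suc M ^ value k ℚ.≤ 1/[ suc M ]
    w≤ = subst (1/ suc M ^ value k ℚ.≤_) (1/^1 M) (1/^-anti M (bound-ℕ≥ k))
    identity : ∀ D p k → (1ℚ ℚ.+ 1ℚ) ℚ.* D ℚ.* p ℚ.+ (k ℚ.+ k) ℚ.* (D ℚ.* p) ≡
                         (1ℚ ℚ.+ 1ℚ) ℚ.* D ℚ.* (p ℚ.* (1ℚ ℚ.+ k))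
    identity = solve-∀ ℚ-ring

  Q W : ℕ → ℚ
  Q M = P (suc M) ℚ.* 1/[ suc M ]
  W M = P (suc M) ℚ.* P (suc M) ℚ.* 1/[ suc M ]

  r≡ : ∀ M → 1/[ 2 ℕ.+ M ] ≡ h (suc M) ℚ.+ h (suc M)
  r≡ M = sym (h+h (suc M))

  s≡ : ∀ M → let r = h (suc M) ℚ.+ h (suc M) ; s = 1/[ suc M ] in s ≡ r ℚ.+ r ℚ.* s
  s≡ M = subst (λ r → 1/[ suc M ] ≡ r ℚ.+ r ℚ.* 1/[ suc M ]) (r≡ M) (1/-step M)

  s≡² : ∀ M → let r = h (suc M) ℚ.+ h (suc M) ; s = 1/[ suc M ] in
        s ≡ r ℚ.+ r ℚ.* (r ℚ.+ r ℚ.* s)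
  s≡² M = trans (s≡ M) (cong (λ q → r ℚ.+ r ℚ.* q) (s≡ M))
    where r = h (suc M) ℚ.+ h (suc M)

  s≡³ : ∀ M → let r = h (suc M) ℚ.+ h (suc M) ; s = 1/[ suc M ] in
        s ≡ r ℚ.+ r ℚ.* (r ℚ.+ r ℚ.* (r ℚ.+ r ℚ.* s))
  s≡³ M = trans (s≡ M) (cong (λ q → r ℚ.+ r ℚ.* q) (s≡² M))
    where r = h (suc M) ℚ.+ h (suc M)

  W-step : ∀ M → W (suc M) ℚ.≤ W M
  W-step M = ≤-from-diff d 0≤d (begin
    p ℚ.* p ℚ.* s
      ≡⟨ cong (p ℚ.* p ℚ.*_) (s≡³ M) ⟩
    p ℚ.* p ℚ.* ((k ℚ.+ k) ℚ.+ (k ℚ.+ k) ℚ.* ((k ℚ.+ k) ℚ.+ (k ℚ.+ k) ℚ.* ((k ℚ.+ k) ℚ.+ (k ℚ.+ k) ℚ.* s)))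
      ≡⟨ identity p k s ⟩
    p ℚ.* (1ℚ ℚ.+ k) ℚ.* (p ℚ.* (1ℚ ℚ.+ k)) ℚ.* (k ℚ.+ k) ℚ.+ d
      ≡⟨ cong (λ r → p ℚ.* (1ℚ ℚ.+ k) ℚ.* (p ℚ.* (1ℚ ℚ.+ k)) ℚ.* r ℚ.+ d) (r≡ M) ⟨
    W (suc M) ℚ.+ d ∎)
    where
    open ≡-Reasoning
    p = P (suc M)
    k = h (suc M)
    s = 1/[ suc M ]
    d = p ℚ.* p ℚ.* ((k ℚ.+ k) ℚ.* (k ℚ.* k ℚ.+ k ℚ.* k ℚ.+ k ℚ.* k ℚ.+ (k ℚ.+ k) ℚ.* (k ℚ.+ k) ℚ.* s))
    0≤k = ℚ.<⇒≤ (0<h (suc M))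
    0≤p = ℚ.<⇒≤ (0<P (suc M))
    0≤2k = +-nonNeg 0≤k 0≤k
    0≤kk = *-nonNeg 0≤k 0≤k
    0≤d : 0ℚ ℚ.≤ d
    0≤d = *-nonNeg (*-nonNeg 0≤p 0≤p) (*-nonNeg 0≤2k
      (+-nonNeg (+-nonNeg (+-nonNeg 0≤kk 0≤kk) 0≤kk)
        (*-nonNeg (*-nonNeg 0≤2k 0≤2k) (0≤1/ (suc M)))))
    identity : ∀ p k s →
      p ℚ.* p ℚ.* ((k ℚ.+ k) ℚ.+ (k ℚ.+ k) ℚ.* ((k ℚ.+ k) ℚ.+ (k ℚ.+ k) ℚ.* ((k ℚ.+ k) ℚ.+ (k ℚ.+ k) ℚ.* s))) ≡
      p ℚ.* (1ℚ ℚ.+ k) ℚ.* (p ℚ.* (1ℚ ℚ.+ k)) ℚ.* (k ℚ.+ k) ℚ.+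
      p ℚ.* p ℚ.* ((k ℚ.+ k) ℚ.* (k ℚ.* k ℚ.+ k ℚ.* k ℚ.+ k ℚ.* k ℚ.+ (k ℚ.+ k) ℚ.* (k ℚ.+ k) ℚ.* s))
    identity = solve-∀ ℚ-ring

  W≤W₀ : ∀ M → W M ℚ.≤ W 0
  W≤W₀ zero    = ℚ.≤-refl
  W≤W₀ (suc M) = ℚ.≤-trans (W-step M) (W≤W₀ M)

  0<Q : ∀ M → 0ℚ ℚ.< Q M
  0<Q M = *-pos (0<P (suc M)) (0<1/ (suc M))

  0<W : ∀ M → 0ℚ ℚ.< W M
  0<W M = *-pos (*-pos (0<P (suc M)) (0<P (suc M))) (0<1/ (suc M))

  Q-small : ∀ c ε → 0ℚ ℚ.< c → 0ℚ ℚ.< ε → ∃ λ N → c ℚ.* Q N ℚ.< ε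
  Q-small c ε 0<c 0<ε =
    let δ , 0<δ , ε²≡ = div (ε ℚ.* ε) (c ℚ.* c ℚ.* W 0) (*-pos 0<ε 0<ε) 0<ccW
        N , 1/N<δ     = archimedean δ 0<δ
    in N , ℚ.≰⇒> (λ ε≤cQ → ℚ.<-irrefl refl (contra N δ ε²≡ 1/N<δ ε≤cQ))
    where
    open ℚ.≤-Reasoning
    0<ccW = *-pos (*-pos 0<c 0<c) (0<W 0)
    0≤cc = ℚ.<⇒≤ (*-pos 0<c 0<c)
    square : ∀ c p s → c ℚ.* (p ℚ.* s) ℚ.* (c ℚ.* (p ℚ.* s)) ≡ c ℚ.* c ℚ.* (p ℚ.* p ℚ.* s) ℚ.* s
    square = solve-∀ ℚ-ring
    contra : ∀ N δ → ε ℚ.* ε ≡ c ℚ.* c ℚ.* W 0 ℚ.* δ → 1/[ suc N ] ℚ.< δ →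
             ε ℚ.≤ c ℚ.* Q N → ε ℚ.* ε ℚ.< ε ℚ.* ε
    contra N δ ε²≡ 1/N<δ ε≤cQ = begin-strict
      ε ℚ.* ε                                 ≤⟨ *-mono-≤ (ℚ.≤-trans (ℚ.<⇒≤ 0<ε) ε≤cQ) (ℚ.<⇒≤ 0<ε) ε≤cQ ε≤cQ ⟩
      c ℚ.* Q N ℚ.* (c ℚ.* Q N)               ≡⟨ square c (P (suc N)) 1/[ suc N ] ⟩
      c ℚ.* c ℚ.* W N ℚ.* 1/[ suc N ]         ≤⟨ *-mono-≤ (ℚ.<⇒≤ 0<ccW) (0≤1/ (suc N))
                                                   (*-mono-≤ 0≤cc (ℚ.<⇒≤ (0<W N)) ℚ.≤-refl (W≤W₀ N)) ℚ.≤-refl ⟩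
      c ℚ.* c ℚ.* W 0 ℚ.* 1/[ suc N ]         <⟨ ℚ.*-monoʳ-<-pos (c ℚ.* c ℚ.* W 0) {{ℚ.positive 0<ccW}} 1/N<δ ⟩
      c ℚ.* c ℚ.* W 0 ℚ.* δ                   ≡⟨ ε²≡ ⟨
      ε ℚ.* ε                                 ∎

  below : ∀ {L B} x y → x ℚ.≤ L ℚ.+ B → L ℚ.≤ y → x ℚ.- y ℚ.≤ B
  below {L} {B} x y x≤ L≤y =
    subst (x ℚ.- y ℚ.≤_) (cancel L B) (ℚ.+-mono-≤ x≤ (ℚ.neg-antimono-≤ L≤y))
    where
    cancel : ∀ L B → L ℚ.+ B ℚ.- L ≡ B
    cancel = solve-∀ ℚ-ring

  between : ∀ L B x y → L ℚ.≤ x → x ℚ.≤ L ℚ.+ B → L ℚ.≤ y → y ℚ.≤ L ℚ.+ B →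
            ℚ.∣ x ℚ.- y ∣ ℚ.≤ B
  between L B x y L≤x x≤ L≤y y≤ = [ pos-case , neg-case ]′ (ℚ.∣p∣≡p∨∣p∣≡-p (x ℚ.- y))
    where
    flip-sub : ∀ a b → ℚ.- (a ℚ.- b) ≡ b ℚ.- a
    flip-sub = solve-∀ ℚ-ring
    pos-case : ℚ.∣ x ℚ.- y ∣ ≡ x ℚ.- y → ℚ.∣ x ℚ.- y ∣ ℚ.≤ B
    pos-case eq = subst (ℚ._≤ B) (sym eq) (below {L} x y x≤ L≤y)
    neg-case : ℚ.∣ x ℚ.- y ∣ ≡ ℚ.- (x ℚ.- y) → ℚ.∣ x ℚ.- y ∣ ℚ.≤ B
    neg-case eq = subst (ℚ._≤ B) (sym (trans eq (flip-sub x y))) (below {L} y x y≤ L≤x)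

  ζ≤-mono : ∀ M k ks → ζ≤ M (k ∷ ks) ℚ.≤ ζ≤ (suc M) (k ∷ ks)
  ζ≤-mono M k ks = ≤-from-diff (1/ suc M ^ value k ℚ.* ζ≤ M ks)
    (*-nonNeg (1/^-pos M (value k)) (0≤ζ≤ M ks)) refl

  ζ≤-tail : ∀ M (k : ℕ≥ 2) ks → let c = 2^ (suc (length ks)) in
    ζ≤ (2 ℕ.+ M) (pos k ∷ ks) ℚ.+ c ℚ.* Q (suc M) ℚ.≤ ζ≤ (suc M) (pos k ∷ ks) ℚ.+ c ℚ.* Q M
  ζ≤-tail M k ks = begin
    z ℚ.+ w ℚ.* ζ≤ (suc M) ks ℚ.+ c ℚ.* (p ℚ.* (1ℚ ℚ.+ j) ℚ.* 1/[ 2 ℕ.+ M ])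
      ≤⟨ ℚ.+-monoˡ-≤ _ (ℚ.+-monoʳ-≤ z (*-mono-≤ (*-nonNeg 0≤r 0≤r) (0≤ζ≤ (suc M) ks)
           w≤ (ζ≤-bound (suc M) ks))) ⟩
    z ℚ.+ 1/[ 2 ℕ.+ M ] ℚ.* 1/[ 2 ℕ.+ M ] ℚ.* (D ℚ.* p) ℚ.+ c ℚ.* (p ℚ.* (1ℚ ℚ.+ j) ℚ.* 1/[ 2 ℕ.+ M ])
      ≡⟨ cong (λ r → z ℚ.+ r ℚ.* r ℚ.* (D ℚ.* p) ℚ.+ c ℚ.* (p ℚ.* (1ℚ ℚ.+ j) ℚ.* r)) (r≡ M) ⟩
    z ℚ.+ (j ℚ.+ j) ℚ.* (j ℚ.+ j) ℚ.* (D ℚ.* p) ℚ.+ c ℚ.* (p ℚ.* (1ℚ ℚ.+ j) ℚ.* (j ℚ.+ j))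
      ≤⟨ ≤-from-diff d 0≤d (identity z D p j s) ⟩
    z ℚ.+ c ℚ.* (p ℚ.* ((j ℚ.+ j) ℚ.+ (j ℚ.+ j) ℚ.* ((j ℚ.+ j) ℚ.+ (j ℚ.+ j) ℚ.* s)))
      ≡⟨ cong (λ q → z ℚ.+ c ℚ.* (p ℚ.* q)) (s≡² M) ⟨
    z ℚ.+ c ℚ.* (p ℚ.* s) ∎
    where
    open ℚ.≤-Reasoning
    D = 2^ (length ks)
    c = (1ℚ ℚ.+ 1ℚ) ℚ.* D
    p = P (suc M)
    j = h (suc M)
    s = 1/[ suc M ]
    w = 1/ 2 ℕ.+ M ^ value k
    z = ζ≤ (suc M) (pos k ∷ ks)
    0≤r = 0≤1/ (2 ℕ.+ M)
    0≤2j = ℚ.<⇒≤ (ℚ.+-mono-< (0<h (suc M)) (0<h (suc M)))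
    w≤ : w ℚ.≤ 1/[ 2 ℕ.+ M ] ℚ.* 1/[ 2 ℕ.+ M ]
    w≤ = subst (w ℚ.≤_) (1/^2 (suc M)) (1/^-anti (suc M) (bound-ℕ≥ k))
    d = c ℚ.* p ℚ.* ((j ℚ.+ j) ℚ.* ((j ℚ.+ j) ℚ.* s))
    0≤d : 0ℚ ℚ.≤ d
    0≤d = *-nonNeg (ℚ.<⇒≤ (*-pos (0<2^ (suc (length ks))) (0<P (suc M))))
      (*-nonNeg 0≤2j (*-nonNeg 0≤2j (0≤1/ (suc M))))
    identity : ∀ z D p j s → let c = (1ℚ ℚ.+ 1ℚ) ℚ.* D in
      z ℚ.+ c ℚ.* (p ℚ.* ((j ℚ.+ j) ℚ.+ (j ℚ.+ j) ℚ.* ((j ℚ.+ j) ℚ.+ (j ℚ.+ j) ℚ.* s))) ≡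
      z ℚ.+ (j ℚ.+ j) ℚ.* (j ℚ.+ j) ℚ.* (D ℚ.* p) ℚ.+ c ℚ.* (p ℚ.* (1ℚ ℚ.+ j) ℚ.* (j ℚ.+ j))
        ℚ.+ c ℚ.* p ℚ.* ((j ℚ.+ j) ℚ.* ((j ℚ.+ j) ℚ.* s))
    identity = solve-∀ ℚ-ring

  abstract
    cauchy-ζ≤ : ∀ (k : ℕ≥ 2) ks → Cauchy (λ M → ζ≤ M (pos k ∷ ks))
    cauchy-ζ≤ k ks ε 0<ε =
      let N , cQ<ε = Q-small c ε (0<2^ (suc (length ks))) 0<ε
      in suc N , close N cQ<ε
      where
      c : ℚ
      c = 2^ (suc (length ks))
      a : ℕ → ℚ
      a M = ζ≤ (suc M) (pos k ∷ ks)
      mono : ∀ N i → a N ℚ.≤ a (i ℕ.+ N)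
      mono N zero    = ℚ.≤-refl
      mono N (suc i) = ℚ.≤-trans (mono N i) (ζ≤-mono (suc (i ℕ.+ N)) (pos k) ks)
      anti : ∀ N i → a (i ℕ.+ N) ℚ.+ c ℚ.* Q (i ℕ.+ N) ℚ.≤ a N ℚ.+ c ℚ.* Q N
      anti N zero    = ℚ.≤-refl
      anti N (suc i) = ℚ.≤-trans (ζ≤-tail (i ℕ.+ N) k ks) (anti N i)
      upper : ∀ N i → a (i ℕ.+ N) ℚ.≤ a N ℚ.+ c ℚ.* Q N
      upper N i = ℚ.≤-trans (≤-from-diff (c ℚ.* Q (i ℕ.+ N))
        (ℚ.<⇒≤ (*-pos (0<2^ (suc (length ks))) (0<Q (i ℕ.+ N)))) refl) (anti N i)
      lower′ : ∀ N m → suc N ℕ.≤ m → a N ℚ.≤ ζ≤ m (pos k ∷ ks)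
      lower′ N (suc m) (s≤s N≤m) = subst (λ m → a N ℚ.≤ a m) (ℕ.m∸n+n≡m N≤m) (mono N (m ∸ N))
      upper′ : ∀ N m → suc N ℕ.≤ m → ζ≤ m (pos k ∷ ks) ℚ.≤ a N ℚ.+ c ℚ.* Q N
      upper′ N (suc m) (s≤s N≤m) =
        subst (λ m → a m ℚ.≤ a N ℚ.+ c ℚ.* Q N) (ℕ.m∸n+n≡m N≤m) (upper N (m ∸ N))
      close : ∀ N → c ℚ.* Q N ℚ.< ε → ∀ m n → suc N ℕ.≤ m → suc N ℕ.≤ n →
              ℚ.∣ ζ≤ m (pos k ∷ ks) ℚ.- ζ≤ n (pos k ∷ ks) ∣ ℚ.< ε
      close N cQ<ε m n N<m N<n = ℚ.≤-<-trans
        (between (a N) (c ℚ.* Q N) (ζ≤ m (pos k ∷ ks)) (ζ≤ n (pos k ∷ ks))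
          (lower′ N m N<m) (upper′ N m N<m) (lower′ N n N<n) (upper′ N n N<n))
        cQ<ε

ζ : Index 2 → ℝ
ζ (k , ks) = mkℝ (λ M → ζ≤ M (pos k ∷ ks)) (cauchy-ζ≤ k ks)

ζᵗ : Index 2 → Poly
ζᵗ k@(k₁ , ks) = ∑ (merges k₁ ks) λ q → t ^ₚ (dep k ∸ dep q) *ₚ const (ζ q)

_⋯_ : ℕ → ℕ → List ℕ
a ⋯ b = applyUpTo (a ℕ.+_) (suc b ∸ a)

antidiagonal : ℕ → List (ℕ × ℕ)
antidiagonal k = map (λ i → i , k ∸ i) (0 ⋯ k)

tuples : List ℕ⁺ → ℕ → List (List ℕ⁺)
tuples xs zero    = [] ∷ []
tuples xs (suc N) = cartesianProductWith _∷_ xs (tuples xs N)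

multiple : ℕ⁺ → ℕ → ℕ⁺
multiple (mkℕ≥ p 1≤p) i = mkℕ≥ (suc i ℕ.* p) (ℕ.m≤n⇒m≤n+o (i ℕ.* p) 1≤p)

-- p, 2p, …, Mp
multiples : ℕ⁺ → ℕ → List ℕ⁺
multiples p = applyUpTo (multiple p)

total : List ℕ⁺ → ℕ
total a = sum (map value a)

-- x is an even multiple of p exactly when 2p divides it.
#even : ℕ⁺ → List ℕ⁺ → ℕ
#even p a = length (filter (λ x → 2 ℕ.* value p ∣? value x) a)

𝒜 : ℕ⁺ → ℕ → ℕ → ℕ → List (List ℕ⁺)
𝒜 p N M j = filter (λ a → (total a ℕ.≟ M ℕ.* value p) ×-dec (#even p a ℕ.≟ j))
                   (tuples (multiples p M) N)

-- Restricting the candidates to entries at most Mp loses nothing (∈𝒜), and no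
-- tuple is listed twice (𝒜-unique).

private
  value-injective : ∀ {b} {x y : ℕ≥ b} → value x ≡ value y → x ≡ y
  value-injective refl = refl

  ∈tuples⁺ : ∀ {xs} a → All (_∈ xs) a → a ∈ tuples xs (length a)
  ∈tuples⁺ []      []         = here refl
  ∈tuples⁺ (x ∷ a) (x∈ ∷ a∈) = ∈.∈-cartesianProductWith⁺ _∷_ x∈ (∈tuples⁺ a a∈)

  ∈tuples⁻ : ∀ xs N {a} → a ∈ tuples xs N → length a ≡ N × All (_∈ xs) a
  ∈tuples⁻ xs zero    (here refl) = refl , []
  ∈tuples⁻ xs (suc N) a∈ with ∈.∈-cartesianProductWith⁻ _∷_ xs (tuples xs N) a∈
  ... | _ , _ , x∈ , a′∈ , refl =
    let len , all = ∈tuples⁻ xs N a′∈ in cong suc len , x∈ ∷ all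

  ∈multiples⁻ : ∀ p M {x} → x ∈ multiples p M → value p ∣ value x
  ∈multiples⁻ p M x∈ with ∈.∈-applyUpTo⁻ (multiple p) x∈
  ... | i , _ , refl = divides (suc i) refl

  ∈multiples⁺ : ∀ p M {x} → value p ∣ value x → value x ℕ.≤ M ℕ.* value p →
                x ∈ multiples p M
  ∈multiples⁺ p M {x} (divides zero eq) x≤ =
    ⊥-elim (ℕ.<-irrefl (sym eq) (bound-ℕ≥ x))
  ∈multiples⁺ p M {x} (divides (suc i) eq) x≤ =
    subst (_∈ multiples p M) (value-injective (sym eq)) (∈.∈-applyUpTo⁺ (multiple p)
      (ℕ.*-cancelʳ-≤ (suc i) M (value p) {{ℕ.>-nonZero (bound-ℕ≥ p)}} (subst (ℕ._≤ M ℕ.* value p) eq x≤)))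

  ≤total : ∀ a → All (λ x → value x ℕ.≤ total a) a
  ≤total []      = []
  ≤total (x ∷ a) = ℕ.m≤m+n (value x) (total a)
    ∷ All.map (λ y≤ → ℕ.≤-trans y≤ (ℕ.m≤n+m (total a) (value x))) (≤total a)

∈𝒜 : ∀ p N M j a → a ∈ 𝒜 p N M j ⇔
  (length a ≡ N × All (λ x → value p ∣ value x) a × total a ≡ M ℕ.* value p × #even p a ≡ j)
∈𝒜 p N M j a = mk⇔ to from
  where
  P? = λ a → (total a ℕ.≟ M ℕ.* value p) ×-dec (#even p a ℕ.≟ j)

  to : a ∈ 𝒜 p N M j →
       length a ≡ N × All (λ x → value p ∣ value x) a × total a ≡ M ℕ.* value p × #even p a ≡ j
  to a∈ =
    let a∈tuples , Σa , #a = ∈.∈-filter⁻ P? {xs = tuples (multiples p M) N} a∈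
        len , all          = ∈tuples⁻ (multiples p M) N a∈tuples
    in len , All.map (∈multiples⁻ p M) all , Σa , #a

  from : length a ≡ N × All (λ x → value p ∣ value x) a × total a ≡ M ℕ.* value p × #even p a ≡ j →
         a ∈ 𝒜 p N M j
  from (refl , p∣a , Σa , #a) = ∈.∈-filter⁺ P?
    (∈tuples⁺ a (All.zipWith (λ (p∣x , x≤) → ∈multiples⁺ p M p∣x (subst (_ ℕ.≤_) Σa x≤))
      (p∣a , ≤total a)))
    (Σa , #a)

𝒜-unique : ∀ p N M j → Unique (𝒜 p N M j)
𝒜-unique p N M j = Unique.filter⁺ _ (tuples-unique N)
  where
  multiple-injective : ∀ {i k} → multiple p i ≡ multiple p k → i ≡ k
  multiple-injective {i} {k} eq = ℕ.suc-injective
    (ℕ.*-cancelʳ-≡ (suc i) (suc k) (value p) {{ℕ.>-nonZero (bound-ℕ≥ p)}} (cong value eq))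

  tuples-unique : ∀ N → Unique (tuples (multiples p M) N)
  tuples-unique zero    = [] ∷ []
  tuples-unique (suc N) = Unique.cartesianProductWith⁺ _∷_ List.∷-injective
    (Unique.applyUpTo⁺₁ (multiple p) M (λ i<k _ eq → ℕ.<⇒≢ i<k (multiple-injective eq)))
    (tuples-unique N)

-- For expressions mentioning a₁, which are read as 0 on the empty tuple.
split : List ℕ⁺ → (ℕ⁺ → List ℕ⁺ → Poly) → Poly
split []       f = 0ₚ
split (a₁ ∷ a) f = f a₁ a

{-# OPTIONS --safe #-}
-- For the M-th approximants the identity is exact. Truncating all sums at M turns ζᵗ into
-- Z, the sum over M ≥ m₁ ≥ ⋯ ≥ mₙ ≥ 1 weighted by t to the number of equalities, and Z is
-- multiplicative for the t-harmonic product
--   k w * l v = k (w * l v) + l (k w * v) + (1-2t) (k+l) (w * v) + (t²-t) (k+l) ∘ (w * v),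
-- where (k+l) ∘ adds k+l to the first letter. Unfolding this product on m {p}ⁿ and u {p}ᵛ up to
-- the place of the second large letter leaves products {p}ˣ * {p}ʸ. There a word occurs with
-- coefficient ∏ g_c over its letters c p, where
--   g_{2q+1} = (t²-t)^q (XY)^q (X+Y)  and  g_{2q+2} = (t²-t)^q (1-2t) (XY)^{q+1},
-- read off at XˣYʸ; with o odd letters, e even ones and i the sum of all q, this coefficient is
-- binom(o, x-i-e) (t²-t)^i (1-2t)^e.
module Submission where

open import Level using (Level; 0ℓ)
open import Defs
open import Algebra.Bundles using (CommutativeRing)
open import Algebra.Bundles.Raw using (RawRing)
import Algebra.Morphism.RingMonomorphism as RingMonomorphism
open import Algebra.Structures using (IsCommutativeRing)
open import Data.Bool.Base using (T; true; false)
open import Data.Integer.Base as ℤ using ()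
open import Data.List.Base
  using (List; []; _∷_; _++_; map; foldr; replicate; applyUpTo; length)
open import Data.List.Membership.Propositional using (_∈_)
import Data.List.Membership.Propositional.Properties as ∈
import Data.List.Membership.Propositional.Properties.WithK as ∈
import Data.List.Properties as List
open import Data.List.Relation.Binary.BagAndSetEquality using (∼bag⇒↭)
open import Data.List.Relation.Binary.Permutation.Propositional using (_↭_; ↭⇒↭ₛ′)
import Data.List.Relation.Binary.Permutation.Propositional.Properties as ↭
open import Data.List.Relation.Unary.All as All using (All; []; _∷_)
import Data.List.Relation.Unary.All.Properties as All
open import Data.List.Relation.Unary.AllPairs using ([]; _∷_)
open import Data.List.Relation.Unary.Any using (here)
open import Data.List.Relation.Unary.Unique.Propositional using (Unique)
import Data.List.Relation.Unary.Unique.Propositional.Properties as Unique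
open import Data.Nat.Base as ℕ using (ℕ; zero; suc; _∸_; _⊓_)
open import Data.Nat.Combinatorics
  using (_C_; nCk≡nC[n∸k]; nCn≡1; nCk+nC[k+1]≡[n+1]C[k+1])
open import Data.Nat.Divisibility
  using (_∣_; _∣?_; divides; *-cancelʳ-∣; *-monoˡ-∣; ∣m+n∣m⇒∣n; ∣m∣n⇒∣m+n; ∣-refl; ∣1⇒≡1; _∣0)
import Data.Nat.Properties as ℕ
open import Data.Nat.Tactic.RingSolver using (solve-∀)
open import Data.Product.Base using (_,_; ∃; proj₁; proj₂) renaming (_×_ to _∧_)
open import Data.Rational.Base as ℚ using (0ℚ; 1ℚ)
import Data.Rational.Properties as ℚ
import Data.Rational.Unnormalised.Base as ℚᵘ
import Data.Rational.Unnormalised.Properties as ℚᵘ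
open import Data.Sum.Base using (_⊎_; inj₁; inj₂)
open import Data.Unit.Base using (tt)
open import Function.Bundles using (mk⇔; module Equivalence)
open import Relation.Binary.Core using (Rel)
open import Relation.Binary.PropositionalEquality as ≡ using (_≡_; _≢_)
open import Relation.Nullary.Decidable using (recompute; yes; no)
open import Relation.Nullary.Negation using (¬_; contradiction)

-- Polynomials as coefficient lists

-- The operations on `ℝ` act termwise on approximants, so the polynomials of the theorem are kept as
-- they are, and only their equality is weakened, for each M, to equality of the M-th approximants
-- of all coefficients. For this reason the ring of coefficient lists takes its equality as a
-- parameter. The obstacle to the multiplicativity of Z is the last term of the product: (k+l) ∘
-- does not act on Z by a scalar. It does on the part H of the sum with maximal m₁, so H carries the
-- induction on words, inside an induction on M. The g_c arise from comparing first letters in G = ∑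
-- XˣYʸ ({p}ˣ * {p}ʸ). The product rule says G = 1 + (X+Y) p G + (1-2t) XY (2p) G + (t²-t) XY (2p) ∘
-- G, whence g_1 = X+Y, g_2 = (1-2t) XY and g_{c+2} = (t²-t) XY g_c.

module PolynomialRing
  {c ℓ ℓ′ : Level} (R : RawRing c ℓ) (_≋_ : Rel (RawRing.Carrier R) ℓ′)
  (isCommutativeRing : IsCommutativeRing _≋_
    (RawRing._+_ R) (RawRing._*_ R) (RawRing.-_ R) (RawRing.0# R) (RawRing.1# R))
  where

  private
    coefficientRing : CommutativeRing c ℓ′
    coefficientRing = record { isCommutativeRing = isCommutativeRing }

    open CommutativeRing coefficientRing hiding (_-_)
    open Polynomial R hiding (rawRing) renaming (const to constant)
    open import Algebra.Properties.CommutativeSemigroup +-commutativeSemigroup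
      using (interchange; x∙yz≈y∙xz)
    open import Relation.Binary.Reasoning.Setoid setoid

    infix 4 _≈ᶜ_
    _≈ᶜ_ : Rel (List Carrier) ℓ′
    f ≈ᶜ g = ∀ i → coeff f i ≈ coeff g i

    negate : List Carrier → List Carrier
    negate = map (-_)

    coeff-add : ∀ f g i → coeff (add f g) i ≈ coeff f i + coeff g i
    coeff-add []      g       i       = sym (+-identityˡ _)
    coeff-add (a ∷ f) []      i       = sym (+-identityʳ _)
    coeff-add (a ∷ f) (b ∷ g) zero    = refl
    coeff-add (a ∷ f) (b ∷ g) (suc i) = coeff-add f g i

    coeff-scale : ∀ a f i → coeff (map (a *_) f) i ≈ a * coeff f i
    coeff-scale a []      i       = sym (zeroʳ a)
    coeff-scale a (b ∷ f) zero    = refl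
    coeff-scale a (b ∷ f) (suc i) = coeff-scale a f i

    coeff-neg : ∀ f i → coeff (negate f) i ≈ - coeff f i
    coeff-neg []      i       = trans (sym (-‿inverseʳ 0#)) (+-identityˡ _)
    coeff-neg (a ∷ f) zero    = refl
    coeff-neg (a ∷ f) (suc i) = coeff-neg f i

    coeff-mul-zero : ∀ a f g → coeff (mul (a ∷ f) g) 0 ≈ a * coeff g 0
    coeff-mul-zero a f g = trans (coeff-add (map (a *_) g) _ 0)
      (trans (+-identityʳ _) (coeff-scale a g 0))

    coeff-mul-suc : ∀ a f g i →
      coeff (mul (a ∷ f) g) (suc i) ≈ a * coeff g (suc i) + coeff (mul f g) i
    coeff-mul-suc a f g i = trans (coeff-add (map (a *_) g) _ (suc i))
      (+-congʳ (coeff-scale a g (suc i)))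

    mul-distribˡ : ∀ f g h → mul f (add g h) ≈ᶜ add (mul f g) (mul f h)
    mul-distribˡ []      g h i    = refl
    mul-distribˡ (a ∷ f) g h zero = begin
      coeff (mul (a ∷ f) (add g h)) 0                   ≈⟨ coeff-mul-zero a f (add g h) ⟩
      a * coeff (add g h) 0                             ≈⟨ *-congˡ (coeff-add g h 0) ⟩
      a * (coeff g 0 + coeff h 0)                       ≈⟨ distribˡ a _ _ ⟩
      a * coeff g 0 + a * coeff h 0
        ≈⟨ +-cong (coeff-mul-zero a f g) (coeff-mul-zero a f h) ⟨
      coeff (mul (a ∷ f) g) 0 + coeff (mul (a ∷ f) h) 0 ≈⟨ coeff-add (mul (a ∷ f) g) _ 0 ⟨
      coeff (add (mul (a ∷ f) g) (mul (a ∷ f) h)) 0     ∎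
    mul-distribˡ (a ∷ f) g h (suc i) = begin
      coeff (mul (a ∷ f) (add g h)) (suc i)
        ≈⟨ coeff-mul-suc a f (add g h) i ⟩
      a * coeff (add g h) (suc i) + coeff (mul f (add g h)) i
        ≈⟨ +-cong (trans (*-congˡ (coeff-add g h (suc i))) (distribˡ a _ _))
                  (trans (mul-distribˡ f g h i) (coeff-add (mul f g) (mul f h) i)) ⟩
      (a * coeff g (suc i) + a * coeff h (suc i)) + (coeff (mul f g) i + coeff (mul f h) i)
        ≈⟨ interchange _ _ _ _ ⟩
      (a * coeff g (suc i) + coeff (mul f g) i) + (a * coeff h (suc i) + coeff (mul f h) i)
        ≈⟨ +-cong (coeff-mul-suc a f g i) (coeff-mul-suc a f h i) ⟨
      coeff (mul (a ∷ f) g) (suc i) + coeff (mul (a ∷ f) h) (suc i)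
        ≈⟨ coeff-add (mul (a ∷ f) g) _ (suc i) ⟨
      coeff (add (mul (a ∷ f) g) (mul (a ∷ f) h)) (suc i) ∎

    mul-[] : ∀ f → mul f [] ≈ᶜ []
    mul-[] []      i       = refl
    mul-[] (a ∷ f) zero    = refl
    mul-[] (a ∷ f) (suc i) = mul-[] f i

    coeff-mul-∷-zero : ∀ f b g → coeff (mul f (b ∷ g)) 0 ≈ coeff f 0 * b
    coeff-mul-∷-zero []      b g = sym (zeroˡ b)
    coeff-mul-∷-zero (a ∷ f) b g = coeff-mul-zero a f (b ∷ g)

    -- The mirror image of `coeff-mul-suc`: `mul` recurses on its first factor, and commutativity
    -- requires the same expansion along the second.
    coeff-mul-∷-suc : ∀ f b g i →
      coeff (mul f (b ∷ g)) (suc i) ≈ coeff f (suc i) * b + coeff (mul f g) i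
    coeff-mul-∷-suc []      b g i    = sym (trans (+-congʳ (zeroˡ b)) (+-identityˡ _))
    coeff-mul-∷-suc (a ∷ f) b g zero = begin
      coeff (mul (a ∷ f) (b ∷ g)) 1                ≈⟨ coeff-mul-suc a f (b ∷ g) 0 ⟩
      a * coeff g 0 + coeff (mul f (b ∷ g)) 0      ≈⟨ +-comm _ _ ⟩
      coeff (mul f (b ∷ g)) 0 + a * coeff g 0
        ≈⟨ +-cong (coeff-mul-∷-zero f b g) (sym (coeff-mul-zero a f g)) ⟩
      coeff f 0 * b + coeff (mul (a ∷ f) g) 0      ∎
    coeff-mul-∷-suc (a ∷ f) b g (suc i) = begin
      coeff (mul (a ∷ f) (b ∷ g)) (suc (suc i))
        ≈⟨ coeff-mul-suc a f (b ∷ g) (suc i) ⟩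
      a * coeff g (suc i) + coeff (mul f (b ∷ g)) (suc i)
        ≈⟨ +-congˡ (coeff-mul-∷-suc f b g i) ⟩
      a * coeff g (suc i) + (coeff f (suc i) * b + coeff (mul f g) i)
        ≈⟨ x∙yz≈y∙xz _ _ _ ⟩
      coeff f (suc i) * b + (a * coeff g (suc i) + coeff (mul f g) i)
        ≈⟨ +-congˡ (coeff-mul-suc a f g i) ⟨
      coeff f (suc i) * b + coeff (mul (a ∷ f) g) (suc i) ∎

    mul-comm : ∀ f g → mul f g ≈ᶜ mul g f
    mul-comm []      g i       = sym (mul-[] g i)
    mul-comm (a ∷ f) g zero    = trans (coeff-mul-zero a f g)
      (trans (*-comm a _) (sym (coeff-mul-∷-zero g a f)))
    mul-comm (a ∷ f) g (suc i) = trans (coeff-mul-suc a f g i)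
      (trans (+-cong (*-comm a _) (mul-comm f g i)) (sym (coeff-mul-∷-suc g a f i)))

    add-cong : ∀ {f f′ g g′} → f ≈ᶜ f′ → g ≈ᶜ g′ → add f g ≈ᶜ add f′ g′
    add-cong {f} {f′} {g} {g′} f≈ g≈ i =
      trans (coeff-add f g i) (trans (+-cong (f≈ i) (g≈ i)) (sym (coeff-add f′ g′ i)))

    mul-congˡ : ∀ f {g g′} → g ≈ᶜ g′ → mul f g ≈ᶜ mul f g′
    mul-congˡ []      g≈ i       = refl
    mul-congˡ (a ∷ f) {g} {g′} g≈ zero = trans (coeff-mul-zero a f g)
      (trans (*-congˡ (g≈ 0)) (sym (coeff-mul-zero a f g′)))
    mul-congˡ (a ∷ f) {g} {g′} g≈ (suc i) = trans (coeff-mul-suc a f g i)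
      (trans (+-cong (*-congˡ (g≈ (suc i))) (mul-congˡ f g≈ i)) (sym (coeff-mul-suc a f g′ i)))

    -- Equal polynomials may have lists of different lengths, so recursion can only vary the second
    -- factor; commutativity moves the first one there.
    mul-cong : ∀ {f f′ g g′} → f ≈ᶜ f′ → g ≈ᶜ g′ → mul f g ≈ᶜ mul f′ g′
    mul-cong {f} {f′} {g} {g′} f≈ g≈ i = trans (mul-congˡ f g≈ i)
      (trans (mul-comm f g′ i) (trans (mul-congˡ g′ f≈ i) (mul-comm g′ f′ i)))

    mul-distribʳ : ∀ h f g → mul (add f g) h ≈ᶜ add (mul f h) (mul g h)
    mul-distribʳ h f g i = trans (mul-comm (add f g) h i) (trans (mul-distribˡ h f g i)
      (add-cong {mul h f} {mul f h} (mul-comm h f) (mul-comm h g) i))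

    mul-scale : ∀ a f g → mul (map (a *_) f) g ≈ᶜ map (a *_) (mul f g)
    mul-scale a []      g i    = refl
    mul-scale a (b ∷ f) g zero = begin
      coeff (mul (a * b ∷ map (a *_) f) g) 0 ≈⟨ coeff-mul-zero (a * b) (map (a *_) f) g ⟩
      a * b * coeff g 0                      ≈⟨ *-assoc a b _ ⟩
      a * (b * coeff g 0)                    ≈⟨ *-congˡ (coeff-mul-zero b f g) ⟨
      a * coeff (mul (b ∷ f) g) 0            ≈⟨ coeff-scale a (mul (b ∷ f) g) 0 ⟨
      coeff (map (a *_) (mul (b ∷ f) g)) 0   ∎
    mul-scale a (b ∷ f) g (suc i) = begin
      coeff (mul (a * b ∷ map (a *_) f) g) (suc i)
        ≈⟨ coeff-mul-suc (a * b) (map (a *_) f) g i ⟩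
      a * b * coeff g (suc i) + coeff (mul (map (a *_) f) g) i
        ≈⟨ +-cong (*-assoc a b _) (trans (mul-scale a f g i) (coeff-scale a (mul f g) i)) ⟩
      a * (b * coeff g (suc i)) + a * coeff (mul f g) i
        ≈⟨ distribˡ a _ _ ⟨
      a * (b * coeff g (suc i) + coeff (mul f g) i)
        ≈⟨ *-congˡ (coeff-mul-suc b f g i) ⟨
      a * coeff (mul (b ∷ f) g) (suc i)
        ≈⟨ coeff-scale a (mul (b ∷ f) g) (suc i) ⟨
      coeff (map (a *_) (mul (b ∷ f) g)) (suc i) ∎

    mul-assoc : ∀ f g h → mul (mul f g) h ≈ᶜ mul f (mul g h)
    mul-assoc []      g h i = refl
    mul-assoc (a ∷ f) g h i = trans (mul-distribʳ h (map (a *_) g) (0# ∷ mul f g) i)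
      (add-cong {mul (map (a *_) g) h} {map (a *_) (mul g h)} (mul-scale a g h) shifted i)
      where
      shifted : mul (0# ∷ mul f g) h ≈ᶜ 0# ∷ mul f (mul g h)
      shifted zero    = trans (coeff-mul-zero 0# (mul f g) h) (zeroˡ _)
      shifted (suc j) = trans (coeff-mul-suc 0# (mul f g) h j)
        (trans (+-congʳ (zeroˡ _)) (trans (+-identityˡ _) (mul-assoc f g h j)))

    mul-identityˡ : ∀ f → mul (constant 1#) f ≈ᶜ f
    mul-identityˡ f zero    = trans (coeff-mul-zero 1# [] f) (*-identityˡ _)
    mul-identityˡ f (suc i) =
      trans (coeff-mul-suc 1# [] f i) (trans (+-identityʳ _) (*-identityˡ _))

    add-comm : ∀ f g → add f g ≈ᶜ add g f
    add-comm f g i = trans (coeff-add f g i) (trans (+-comm _ _) (sym (coeff-add g f i)))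

    add-assoc : ∀ f g h → add (add f g) h ≈ᶜ add f (add g h)
    add-assoc f g h i = begin
      coeff (add (add f g) h) i           ≈⟨ coeff-add (add f g) h i ⟩
      coeff (add f g) i + coeff h i       ≈⟨ +-congʳ (coeff-add f g i) ⟩
      coeff f i + coeff g i + coeff h i   ≈⟨ +-assoc _ _ _ ⟩
      coeff f i + (coeff g i + coeff h i) ≈⟨ +-congˡ (coeff-add g h i) ⟨
      coeff f i + coeff (add g h) i       ≈⟨ coeff-add f (add g h) i ⟨
      coeff (add f (add g h)) i           ∎

    add-identityʳ : ∀ f → add f [] ≈ᶜ f
    add-identityʳ f i = trans (coeff-add f [] i) (+-identityʳ _)

    add-inverseʳ : ∀ f → add f (negate f) ≈ᶜ []
    add-inverseʳ f i = trans (coeff-add f (negate f) i)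
      (trans (+-congˡ (coeff-neg f i)) (-‿inverseʳ _))

    negate-cong : ∀ {f g} → f ≈ᶜ g → negate f ≈ᶜ negate g
    negate-cong {f} {g} f≈g i =
      trans (coeff-neg f i) (trans (-‿cong (f≈g i)) (sym (coeff-neg g i)))

  -- A record, so that unification recovers f and g from f ≈ₗ g.
  infix 4 _≈ₗ_
  record _≈ₗ_ (f g : List Carrier) : Set ℓ′ where
    constructor coefficientwise
    field coeff-≈ : ∀ i → coeff f i ≈ coeff g i

  open _≈ₗ_ public

  commutativeRing : CommutativeRing c ℓ′
  commutativeRing = record
    { Carrier = List Carrier
    ; _≈_ = _≈ₗ_ ; _+_ = add ; _*_ = mul ; -_ = negate ; 0# = [] ; 1# = constant 1#
    ; isCommutativeRing = record
      { isRing = record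
        { +-isAbelianGroup = record
          { isGroup = record
            { isMonoid = record
              { isSemigroup = record
                { isMagma = record
                  { isEquivalence = record
                    { refl  = coefficientwise λ _ → refl
                    ; sym   = λ f≈g → coefficientwise λ i → sym (coeff-≈ f≈g i)
                    ; trans = λ f≈g g≈h → coefficientwise λ i → trans (coeff-≈ f≈g i) (coeff-≈ g≈h i)
                    }
                  ; ∙-cong = λ {f} {f′} f≈ g≈ →
                      coefficientwise (add-cong {f} {f′} (coeff-≈ f≈) (coeff-≈ g≈))
                  }
                ; assoc = λ f g h → coefficientwise (add-assoc f g h)
                }
              ; identity = (λ _ → coefficientwise λ _ → refl) , λ f → coefficientwise (add-identityʳ f)
              }
            ; inverse = (λ f → coefficientwise λ i → trans (add-comm (negate f) f i) (add-inverseʳ f i)) ,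
                λ f → coefficientwise (add-inverseʳ f)
            ; ⁻¹-cong = λ {f} {g} f≈g → coefficientwise (negate-cong {f} {g} (coeff-≈ f≈g))
            }
          ; comm = λ f g → coefficientwise (add-comm f g)
          }
        ; *-cong     = λ {f} {f′} f≈ g≈ →
            coefficientwise (mul-cong {f} {f′} (coeff-≈ f≈) (coeff-≈ g≈))
        ; *-assoc    = λ f g h → coefficientwise (mul-assoc f g h)
        ; *-identity = (λ f → coefficientwise (mul-identityˡ f)) ,
            λ f → coefficientwise λ i → trans (mul-comm f (constant 1#) i) (mul-identityˡ f i)
        ; distrib    = (λ f g h → coefficientwise (mul-distribˡ f g h)) ,
            λ f g h → coefficientwise (mul-distribʳ f g h)
        }
      ; *-comm = λ f g → coefficientwise (mul-comm f g)
      }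
    }

-- Words in multiples of p

ℕ≥-≡ : ∀ {b} {k l : ℕ≥ b} → value k ≡ value l → k ≡ l
ℕ≥-≡ ≡.refl = ≡.refl

-- The bound is an irrelevant field; it is recovered because the order on naturals is decidable.
≤value : ∀ {b} (k : ℕ≥ b) → b ℕ.≤ value k
≤value {b} (mkℕ≥ x b≤x) = recompute (b ℕ.≤? x) b≤x

-- The key will be the first entry of a word, with 0 for the empty word; it separates the four lists
-- that make up `words`.
unique-++-by : ∀ {A : Set} (key : A → ℕ) m {xs ys} → Unique xs → Unique ys →
  All (λ x → key x ℕ.≤ m) xs → All (λ y → m ℕ.< key y) ys → Unique (xs ++ ys)
unique-++-by key m uxs uys xs≤ ys> = Unique.++⁺ uxs uys λ (x∈xs , x∈ys) →
  ℕ.<⇒≱ (All.lookup ys> x∈ys) (All.lookup xs≤ x∈xs)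

module Words (p : ℕ⁺) where

  private
    instance
      p≢0 : ℕ.NonZero (value p)
      p≢0 = ℕ.>-nonZero (≤value p)

  -- For even d, the words in multiples of p whose first entry exceeds d p (for d = 0 possibly
  -- the empty word), consisting of o entries (2q + 1) p and e entries (2q + 2) p, where i is
  -- the sum of all q, the one of the first entry being diminished by d / 2.
  mutual
    words : ℕ → ℕ → ℕ → ℕ → List (List ℕ⁺)
    words d o i e = none d o i e ++ odd d o i e ++ even d o i e ++ larger d o i e

    none odd even larger : ℕ → ℕ → ℕ → ℕ → List (List ℕ⁺)
    none zero zero zero zero = [] ∷ []
    none _    _    _    _    = []

    odd d zero    i e = []
    odd d (suc o) i e = map (multiple p d ∷_) (words 0 o i e)

    even d o i zero    = []
    even d o i (suc e) = map (multiple p (suc d) ∷_) (words 0 o i e)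

    larger d o zero    e = []
    larger d o (suc i) e = words (2 ℕ.+ d) o i e

  private
    head′ : List ℕ⁺ → ℕ
    head′ []      = 0
    head′ (x ∷ a) = value x

    multiple-< : ∀ d → d ℕ.* value p ℕ.< suc d ℕ.* value p
    multiple-< d = ℕ.*-monoˡ-< (value p) (ℕ.n<1+n d)

    head′-none : ∀ d o i e → All (λ a → head′ a ℕ.≤ d ℕ.* value p) (none d o i e)
    head′-none zero    zero    zero    zero    = ℕ.z≤n ∷ []
    head′-none zero    zero    zero    (suc e) = []
    head′-none zero    zero    (suc i) e       = []
    head′-none zero    (suc o) i       e       = []
    head′-none (suc d) o       i       e       = []

    head′-odd : ∀ d o i e → All (λ a → head′ a ≡ suc d ℕ.* value p) (odd d o i e)
    head′-odd d zero    i e = []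
    head′-odd d (suc o) i e = All.map⁺ (All.universal (λ _ → ≡.refl) (words 0 o i e))

    head′-even : ∀ d o i e → All (λ a → head′ a ≡ (2 ℕ.+ d) ℕ.* value p) (even d o i e)
    head′-even d o i zero    = []
    head′-even d o i (suc e) = All.map⁺ (All.universal (λ _ → ≡.refl) (words 0 o i e))

    mutual
      head′-larger : ∀ d o i e → All (λ a → (2 ℕ.+ d) ℕ.* value p ℕ.< head′ a) (larger d o i e)
      head′-larger d o zero    e = []
      -- `none (2 + d) o i e` reduces to the empty list, so `words (2 + d) o i e` consists of the
      -- other three lists only.
      head′-larger d o (suc i) e = head′-words (2 ℕ.+ d) o i e

      head′-words : ∀ d o i e →
        All (λ a → d ℕ.* value p ℕ.< head′ a) (odd d o i e ++ even d o i e ++ larger d o i e)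
      head′-words d o i e = All.++⁺
        (All.map (λ eq → ≡.subst (_ ℕ.<_) (≡.sym eq) (multiple-< d)) (head′-odd d o i e))
        (All.map (ℕ.<-trans (multiple-< d)) (head′-even-larger d o i e))

      head′-even-larger : ∀ d o i e →
        All (λ a → suc d ℕ.* value p ℕ.< head′ a) (even d o i e ++ larger d o i e)
      head′-even-larger d o i e = All.++⁺
        (All.map (λ eq → ≡.subst (_ ℕ.<_) (≡.sym eq) (multiple-< (suc d))) (head′-even d o i e))
        (All.map (ℕ.<-trans (multiple-< (suc d))) (head′-larger d o i e))

    none-unique : ∀ d o i e → Unique (none d o i e)
    none-unique zero    zero    zero    zero    = [] ∷ []
    none-unique zero    zero    zero    (suc e) = []
    none-unique zero    zero    (suc i) e       = []
    none-unique zero    (suc o) i       e       = []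
    none-unique (suc d) o       i       e       = []

  mutual
    words-unique : ∀ d o i e → Unique (words d o i e)
    words-unique d o i e =
      unique-++-by head′ (d ℕ.* value p) (none-unique d o i e)
        (unique-++-by head′ (suc d ℕ.* value p) (odd-unique d o i e)
          (unique-++-by head′ ((2 ℕ.+ d) ℕ.* value p) (even-unique d o i e)
            (larger-unique d o i e)
            (All.map ℕ.≤-reflexive (head′-even d o i e)) (head′-larger d o i e))
          (All.map ℕ.≤-reflexive (head′-odd d o i e)) (head′-even-larger d o i e))
        (head′-none d o i e) (head′-words d o i e)

    private
      odd-unique : ∀ d o i e → Unique (odd d o i e)
      odd-unique d zero    i e = []
      odd-unique d (suc o) i e = Unique.map⁺ List.∷-injectiveʳ (words-unique 0 o i e)

      even-unique : ∀ d o i e → Unique (even d o i e)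
      even-unique d o i zero    = []
      even-unique d o i (suc e) = Unique.map⁺ List.∷-injectiveʳ (words-unique 0 o i e)

      larger-unique : ∀ d o i e → Unique (larger d o i e)
      larger-unique d o zero    e = []
      larger-unique d o (suc i) e = words-unique (2 ℕ.+ d) o i e

  private
    -- The characterisation of membership in `𝒜 p N M j` that `∈𝒜` provides.
    Shape : ℕ → ℕ → ℕ → List ℕ⁺ → Set
    Shape N M j a =
      length a ≡ N ∧ All (λ x → value p ∣ value x) a ∧ total a ≡ M ℕ.* value p ∧ #even p a ≡ j

    -- `multiple p d` is (d + 1) p, so even d give the odd multiples.
    multiple-odd : ∀ {d} → 2 ∣ d → ¬ (2 ℕ.* value p ∣ value (multiple p d))
    multiple-odd {d} 2∣d 2p∣ = contradiction
      (∣1⇒≡1 (∣m+n∣m⇒∣n (≡.subst (2 ∣_) (ℕ.+-comm 1 d) (*-cancelʳ-∣ (value p) 2p∣)) 2∣d)) λ()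

    multiple-even : ∀ {d} → 2 ∣ d → 2 ℕ.* value p ∣ value (multiple p (suc d))
    multiple-even 2∣d = *-monoˡ-∣ (value p) (∣m∣n⇒∣m+n ∣-refl 2∣d)

    multiple-∷ : ∀ d {N M j a} → Shape N M j a →
      ∀ {M′ j′} → suc d ℕ.+ M ≡ M′ → #even p (multiple p d ∷ a) ≡ j′ →
      Shape (suc N) M′ j′ (multiple p d ∷ a)
    multiple-∷ d {M = M} (len , p∣a , Σa , #a) M≡ #≡ =
      ≡.cong suc len , divides (suc d) ≡.refl ∷ p∣a ,
      ≡.trans (≡.cong (suc d ℕ.* value p ℕ.+_) Σa)
        (≡.trans (≡.sym (ℕ.*-distribʳ-+ (value p) (suc d) M)) (≡.cong (ℕ._* value p) M≡)) , #≡

    odd-size : ∀ d o i e → suc d ℕ.+ (o ℕ.+ 2 ℕ.* (i ℕ.+ e)) ≡ d ℕ.+ (suc o ℕ.+ 2 ℕ.* (i ℕ.+ e))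
    odd-size = solve-∀

    even-size : ∀ d o i e →
      (2 ℕ.+ d) ℕ.+ (o ℕ.+ 2 ℕ.* (i ℕ.+ e)) ≡ d ℕ.+ (o ℕ.+ 2 ℕ.* (i ℕ.+ suc e))
    even-size = solve-∀

    larger-size : ∀ d o i e →
      (2 ℕ.+ d) ℕ.+ (o ℕ.+ 2 ℕ.* (i ℕ.+ e)) ≡ d ℕ.+ (o ℕ.+ 2 ℕ.* (suc i ℕ.+ e))
    larger-size = solve-∀

    even? = λ (x : ℕ⁺) → 2 ℕ.* value p ∣? value x

    mutual
      -- In units of p, the letters 2q + 1 and 2q + 2 add up to o + 2e plus twice the sum of all q.
      -- This sum is i + d/2, since i counts the first q diminished by d/2.
      words-shape : ∀ d o i e → 2 ∣ d →
        All (Shape (o ℕ.+ e) (d ℕ.+ (o ℕ.+ 2 ℕ.* (i ℕ.+ e))) e) (words d o i e)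
      words-shape d o i e 2∣d = All.++⁺ (none-shape d o i e)
        (All.++⁺ (odd-shape d o i e 2∣d) (All.++⁺ (even-shape d o i e 2∣d) (larger-shape d o i e 2∣d)))

      none-shape : ∀ d o i e →
        All (Shape (o ℕ.+ e) (d ℕ.+ (o ℕ.+ 2 ℕ.* (i ℕ.+ e))) e) (none d o i e)
      none-shape zero    zero    zero    zero    = (≡.refl , [] , ≡.refl , ≡.refl) ∷ []
      none-shape zero    zero    zero    (suc e) = []
      none-shape zero    zero    (suc i) e       = []
      none-shape zero    (suc o) i       e       = []
      none-shape (suc d) o       i       e       = []

      odd-shape : ∀ d o i e → 2 ∣ d →
        All (Shape (o ℕ.+ e) (d ℕ.+ (o ℕ.+ 2 ℕ.* (i ℕ.+ e))) e) (odd d o i e)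
      odd-shape d zero    i e 2∣d = []
      odd-shape d (suc o) i e 2∣d = All.map⁺ (All.map
        (λ {a} sh → multiple-∷ d sh (odd-size d o i e)
          (≡.trans (≡.cong length (List.filter-reject even? {multiple p d} {a} (multiple-odd 2∣d)))
            (proj₂ (proj₂ (proj₂ sh)))))
        (words-shape 0 o i e (2 ∣0)))

      even-shape : ∀ d o i e → 2 ∣ d →
        All (Shape (o ℕ.+ e) (d ℕ.+ (o ℕ.+ 2 ℕ.* (i ℕ.+ e))) e) (even d o i e)
      even-shape d o i zero    2∣d = []
      even-shape d o i (suc e) 2∣d = All.map⁺ (All.map
        (λ {a} sh → ≡.subst
          (λ N → Shape N (d ℕ.+ (o ℕ.+ 2 ℕ.* (i ℕ.+ suc e))) (suc e) (multiple p (suc d) ∷ a))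
          (≡.sym (ℕ.+-suc o e))
          (multiple-∷ (suc d) sh (even-size d o i e)
            (≡.trans (≡.cong length (List.filter-accept even? {multiple p (suc d)} {a} (multiple-even 2∣d)))
              (≡.cong suc (proj₂ (proj₂ (proj₂ sh)))))))
        (words-shape 0 o i e (2 ∣0)))

      larger-shape : ∀ d o i e → 2 ∣ d →
        All (Shape (o ℕ.+ e) (d ℕ.+ (o ℕ.+ 2 ℕ.* (i ℕ.+ e))) e) (larger d o i e)
      larger-shape d o zero    e 2∣d = []
      larger-shape d o (suc i) e 2∣d = All.map
        (λ {a} → ≡.subst (λ M → Shape (o ℕ.+ e) M e a) (larger-size d o i e))
        (words-shape (2 ℕ.+ d) o i e (∣m∣n⇒∣m+n ∣-refl 2∣d))

    ∈-odd : ∀ d o i e {a} → a ∈ words 0 o i e → multiple p d ∷ a ∈ words d (suc o) i e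
    ∈-odd d o i e a∈ = ∈.∈-++⁺ʳ (none d (suc o) i e) (∈.∈-++⁺ˡ (∈.∈-map⁺ _ a∈))

    ∈-even : ∀ d o i e {a} → a ∈ words 0 o i e → multiple p (suc d) ∷ a ∈ words d o i (suc e)
    ∈-even d o i e a∈ = ∈.∈-++⁺ʳ (none d o i (suc e)) (∈.∈-++⁺ʳ (odd d o i (suc e))
      (∈.∈-++⁺ˡ (∈.∈-map⁺ _ a∈)))

    ∈-larger : ∀ d o i e {a} → a ∈ words (2 ℕ.+ d) o i e → a ∈ words d o (suc i) e
    ∈-larger d o i e a∈ = ∈.∈-++⁺ʳ (none d o (suc i) e) (∈.∈-++⁺ʳ (odd d o (suc i) e)
      (∈.∈-++⁺ʳ (even d o (suc i) e) a∈))

    -- Each passage through `larger` takes 2 off c, until the remainder 0 or 1 decides between an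
    -- odd and an even first letter.
    ∈-∷ : ∀ c d o i e {a} → a ∈ words 0 o i e →
      ∃ λ o′ → ∃ λ i′ → ∃ λ e′ → multiple p (c ℕ.+ d) ∷ a ∈ words d o′ i′ e′
    ∈-∷ zero          d o i e a∈ = suc o , i , e , ∈-odd d o i e a∈
    ∈-∷ (suc zero)    d o i e a∈ = o , i , suc e , ∈-even d o i e a∈
    ∈-∷ (suc (suc c)) d o i e {a} a∈ =
      let o′ , i′ , e′ , ∈w = ∈-∷ c (2 ℕ.+ d) o i e a∈
      in o′ , suc i′ , e′ , ∈-larger d o′ i′ e′
        (≡.subst (λ n → multiple p n ∷ a ∈ words (2 ℕ.+ d) o′ i′ e′)
          (≡.trans (ℕ.+-suc c (suc d)) (≡.cong suc (ℕ.+-suc c d))) ∈w)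

    ∈-some-words : ∀ {a} → All (λ x → value p ∣ value x) a →
      ∃ λ o → ∃ λ i → ∃ λ e → a ∈ words 0 o i e
    ∈-some-words []                        = 0 , 0 , 0 , here ≡.refl
    ∈-some-words {x ∷ a} (divides zero eq ∷ p∣a) =
      contradiction (≤value x) (ℕ.<⇒≱ (≡.subst (ℕ._< 1) (≡.sym eq) (ℕ.n<1+n 0)))
    ∈-some-words {x ∷ a} (divides (suc c) eq ∷ p∣a) =
      let o , i , e , a∈      = ∈-some-words p∣a
          o′ , i′ , e′ , x∷a∈ = ∈-∷ c 0 o i e a∈
      in o′ , i′ , e′ , ≡.subst (λ y → y ∷ a ∈ words 0 o′ i′ e′)
           (ℕ≥-≡ (≡.trans (≡.cong (λ n → suc n ℕ.* value p) (ℕ.+-identityʳ c)) (≡.sym eq))) x∷a∈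

    -- Every word in multiples of p lies in some `words 0 o′ i′ e′`. Its number of even letters, its
    -- length and its total then determine e′, o′ and i′ in turn.
    shape⇒∈ : ∀ o i e {a} → Shape (o ℕ.+ e) (o ℕ.+ 2 ℕ.* (i ℕ.+ e)) e a → a ∈ words 0 o i e
    shape⇒∈ o i e {a} (len , p∣a , Σa , #a) with ∈-some-words p∣a
    ... | o′ , i′ , e′ , a∈ with All.lookup (words-shape 0 o′ i′ e′ (2 ∣0)) a∈
    ... | len′ , _ , Σa′ , #a′ with ≡.trans (≡.sym #a′) #a
    ... | ≡.refl with ℕ.+-cancelʳ-≡ e o′ o (≡.trans (≡.sym len′) len)
    ... | ≡.refl with ℕ.+-cancelʳ-≡ e i′ i (ℕ.*-cancelˡ-≡ (i′ ℕ.+ e) (i ℕ.+ e) 2 (ℕ.+-cancelˡ-≡ o _ _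
                        (ℕ.*-cancelʳ-≡ (o ℕ.+ 2 ℕ.* (i′ ℕ.+ e)) (o ℕ.+ 2 ℕ.* (i ℕ.+ e)) (value p)
                          (≡.trans (≡.sym Σa′) Σa))))
    ... | ≡.refl = a∈

  -- Both lists are free of duplicates and have the same members. This trades the filter defining
  -- `𝒜` for a list that can be taken apart by first letters.
  𝒜↭words : ∀ o i e → 𝒜 p (o ℕ.+ e) (o ℕ.+ 2 ℕ.* (i ℕ.+ e)) e ↭ words 0 o i e
  𝒜↭words o i e = ∼bag⇒↭ (∈.unique∧set⇒bag (𝒜-unique p N M e) (words-unique 0 o i e)
    λ {a} → mk⇔
      (λ a∈ → shape⇒∈ o i e (Equivalence.to (∈𝒜 p N M e a) a∈))
      (λ a∈ → Equivalence.from (∈𝒜 p N M e a) (All.lookup (words-shape 0 o i e (2 ∣0)) a∈)))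
    where
    N = o ℕ.+ e
    M = o ℕ.+ 2 ℕ.* (i ℕ.+ e)

-- Needed for the truncated subtraction in the exponent of t: it makes the exponent grow by exactly
-- one when a plus is put in front.
merges-dep : ∀ {b} (k : ℕ≥ b) ks → All (λ q → dep q ℕ.≤ suc (length ks)) (merges k ks)
merges-dep k []        = ℕ.≤-refl ∷ []
merges-dep k (k₂ ∷ ks) = All.++⁺ (All.map⁺ (All.map ℕ.s≤s (merges-dep k₂ ks)))
  (All.map ℕ.m≤n⇒m≤1+n (merges-dep (k +⁺ k₂) ks))

-- Harmonic products

module HarmonicProduct {c ℓ : Level} (A : CommutativeRing c ℓ) where
  open CommutativeRing A hiding (zero)
  open import Relation.Binary.Reasoning.Setoid setoid
  open import Algebra.Properties.CommutativeSemigroup +-commutativeSemigroup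
    using (interchange)
  open import Algebra.Properties.CommutativeSemigroup *-commutativeSemigroup
    using () renaming (x∙yz≈y∙xz to *-exchange)
  open import Algebra.Properties.Monoid.Mult +-monoid
    using (_×_; ×-congʳ; ×-congˡ; ×-homo-1; ×-homo-+)
  open import Algebra.Properties.Semiring.Mult semiring using (×-comm-*)
  open import Algebra.Properties.Semiring.Exp semiring using (_^_)
  open import Data.List.Relation.Binary.Permutation.Setoid.Properties setoid
    using (foldr-commMonoid)
  import Algebra.Solver.Ring.NaturalCoefficients.Default commutativeSemiring as Solver
  open Solver using (solve; _:+_; _:*_; _:=_)

  private variable
    B B′ : Set

  -- Finite sums over lists, initial segments and antidiagonals

  sumOver : List B → (B → Carrier) → Carrier
  sumOver xs f = foldr _+_ 0# (map f xs)

  sumOver-cong : (xs : List B) {f g : B → Carrier} → (∀ x → f x ≈ g x) → sumOver xs f ≈ sumOver xs g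
  sumOver-cong []       eq = refl
  sumOver-cong (x ∷ xs) eq = +-cong (eq x) (sumOver-cong xs eq)

  sumOver-cong-All : {xs : List B} {f g : B → Carrier} → All (λ x → f x ≈ g x) xs → sumOver xs f ≈ sumOver xs g
  sumOver-cong-All []         = refl
  sumOver-cong-All (eq ∷ eqs) = +-cong eq (sumOver-cong-All eqs)

  sumOver-++ : (xs ys : List B) (f : B → Carrier) →
    sumOver (xs ++ ys) f ≈ sumOver xs f + sumOver ys f
  sumOver-++ []       ys f = sym (+-identityˡ _)
  sumOver-++ (x ∷ xs) ys f = trans (+-congˡ (sumOver-++ xs ys f)) (sym (+-assoc _ _ _))

  sumOver-+ : (xs : List B) (f g : B → Carrier) →
    sumOver xs (λ x → f x + g x) ≈ sumOver xs f + sumOver xs g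
  sumOver-+ []       f g = sym (+-identityˡ 0#)
  sumOver-+ (x ∷ xs) f g = trans (+-congˡ (sumOver-+ xs f g)) (interchange _ _ _ _)

  sumOver-map : (h : B → B′) (xs : List B) (f : B′ → Carrier) →
    sumOver (map h xs) f ≡ sumOver xs (λ x → f (h x))
  sumOver-map h xs f = ≡.cong (foldr _+_ 0#) (≡.sym (List.map-∘ xs))

  sumOver-scale : (xs : List B) (x : Carrier) (f : B → Carrier) →
    sumOver xs (λ a → x * f a) ≈ x * sumOver xs f
  sumOver-scale []       x f = sym (zeroʳ x)
  sumOver-scale (_ ∷ xs) x f = trans (+-congˡ (sumOver-scale xs x f)) (sym (distribˡ x _ _))

  sumOver-↭ : {xs ys : List B} (f : B → Carrier) → xs ↭ ys → sumOver xs f ≈ sumOver ys f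
  sumOver-↭ f xs↭ys =
    foldr-commMonoid +-isCommutativeMonoid (↭⇒↭ₛ′ isEquivalence (↭.map⁺ f xs↭ys))

  sum< : ℕ → (ℕ → Carrier) → Carrier
  sum< zero    f = 0#
  sum< (suc n) f = f 0 + sum< n (λ i → f (suc i))

  sum<-cong : ∀ n {f g : ℕ → Carrier} → (∀ i → i ℕ.< n → f i ≈ g i) → sum< n f ≈ sum< n g
  sum<-cong zero    eq = refl
  sum<-cong (suc n) eq = +-cong (eq 0 ℕ.z<s) (sum<-cong n λ i i<n → eq (suc i) (ℕ.s<s i<n))

  sum<-+ : ∀ n f g → sum< n (λ i → f i + g i) ≈ sum< n f + sum< n g
  sum<-+ zero    f g = sym (+-identityˡ 0#)
  sum<-+ (suc n) f g = trans (+-congˡ (sum<-+ n _ _)) (interchange _ _ _ _)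

  sum<-scale : ∀ n x f → sum< n (λ i → x * f i) ≈ x * sum< n f
  sum<-scale zero    x f = sym (zeroʳ x)
  sum<-scale (suc n) x f = trans (+-congˡ (sum<-scale n x _)) (sym (distribˡ x _ _))

  sum<-zero : ∀ n → sum< n (λ _ → 0#) ≈ 0#
  sum<-zero zero    = refl
  sum<-zero (suc n) = trans (+-identityˡ _) (sum<-zero n)

  sumOver-applyUpTo : (h : ℕ → B) (n : ℕ) (f : B → Carrier) →
    sumOver (applyUpTo h n) f ≡ sum< n (λ i → f (h i))
  sumOver-applyUpTo h zero    f = ≡.refl
  sumOver-applyUpTo h (suc n) f = ≡.cong (f (h 0) +_) (sumOver-applyUpTo (λ i → h (suc i)) n f)

  antidiagonalSum : ℕ → (ℕ → ℕ → Carrier) → Carrier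
  antidiagonalSum k f = sum< (suc k) λ i → f i (k ∸ i)

  antidiagonalSum-cong : ∀ k {f g : ℕ → ℕ → Carrier} → (∀ i j → f i j ≈ g i j) →
    antidiagonalSum k f ≈ antidiagonalSum k g
  antidiagonalSum-cong k eq = sum<-cong (suc k) λ i _ → eq i (k ∸ i)

  antidiagonalSum-+ : ∀ k (f g : ℕ → ℕ → Carrier) →
    antidiagonalSum k (λ i j → f i j + g i j) ≈ antidiagonalSum k f + antidiagonalSum k g
  antidiagonalSum-+ k f g = sum<-+ (suc k) (λ i → f i (k ∸ i)) (λ i → g i (k ∸ i))

  antidiagonalSum-scale : ∀ k x (f : ℕ → ℕ → Carrier) →
    antidiagonalSum k (λ i j → x * f i j) ≈ x * antidiagonalSum k f
  antidiagonalSum-scale k x f = sum<-scale (suc k) x (λ i → f i (k ∸ i))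

  -- Induction avoids the side condition i ≤ k under which `suc k ∸ i` equals `suc (k ∸ i)`.
  antidiagonalSum-suc : ∀ k f →
    antidiagonalSum (suc k) f ≈ antidiagonalSum k (λ i j → f i (suc j)) + f (suc k) 0
  antidiagonalSum-suc zero    f =
    trans (+-congˡ (+-identityʳ _)) (+-congʳ (sym (+-identityʳ _)))
  antidiagonalSum-suc (suc k) f =
    trans (+-congˡ (antidiagonalSum-suc k (λ i → f (suc i)))) (sym (+-assoc _ _ _))

  sumOver-antidiagonal : ∀ k (f : ℕ → ℕ → Carrier) →
    sumOver (antidiagonal k) (λ (i , j) → f i j) ≡ antidiagonalSum k f
  sumOver-antidiagonal k f = ≡.trans (sumOver-map (λ i → i , k ∸ i) (0 ⋯ k) (λ (i , j) → f i j))
    (sumOver-applyUpTo (λ i → i) (suc k) (λ i → f i (k ∸ i)))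

  -- The counterpart of `split` over any ring. Its value 0 on the empty word makes (k+l) ∘
  -- annihilate that word, as the t-harmonic product requires.
  onFirst : (ℕ⁺ → List ℕ⁺ → Carrier) → List ℕ⁺ → Carrier
  onFirst f []       = 0#
  onFirst f (a₁ ∷ a) = f a₁ a

  -- The t-harmonic product of two words, as the linear functional Φ ↦ Φ(ws * vs);
  -- the intended coefficients are s = 1 - 2t and r = t² - t.
  module Product (s r : Carrier) where

    ⟨_*_⟩ : List ℕ⁺ → List ℕ⁺ → (List ℕ⁺ → Carrier) → Carrier
    ⟨ []     * vs     ⟩ Φ = Φ vs
    ⟨ k ∷ ws * []     ⟩ Φ = Φ (k ∷ ws)
    ⟨ k ∷ ws * l ∷ vs ⟩ Φ =
        ⟨ ws * l ∷ vs ⟩ (λ a → Φ (k ∷ a)) + ⟨ k ∷ ws * vs ⟩ (λ a → Φ (l ∷ a))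
      + s * ⟨ ws * vs ⟩ (λ a → Φ (k +⁺ l ∷ a))
      + r * ⟨ ws * vs ⟩ (onFirst λ a₁ a → Φ (k +⁺ l +⁺ a₁ ∷ a))

    ⟨*⟩-cong : ∀ ws vs {Φ Ψ} → (∀ a → Φ a ≈ Ψ a) → ⟨ ws * vs ⟩ Φ ≈ ⟨ ws * vs ⟩ Ψ
    ⟨*⟩-cong []       vs       eq = eq vs
    ⟨*⟩-cong (k ∷ ws) []       eq = eq (k ∷ ws)
    ⟨*⟩-cong (k ∷ ws) (l ∷ vs) eq = +-cong (+-cong (+-cong
      (⟨*⟩-cong ws (l ∷ vs) (λ a → eq (k ∷ a)))
      (⟨*⟩-cong (k ∷ ws) vs (λ a → eq (l ∷ a))))
      (*-congˡ (⟨*⟩-cong ws vs (λ a → eq (k +⁺ l ∷ a)))))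
      (*-congˡ (⟨*⟩-cong ws vs λ { [] → refl ; (a₁ ∷ a) → eq (k +⁺ l +⁺ a₁ ∷ a) }))

    ⟨*⟩-+ : ∀ ws vs Φ Ψ → ⟨ ws * vs ⟩ (λ a → Φ a + Ψ a) ≈ ⟨ ws * vs ⟩ Φ + ⟨ ws * vs ⟩ Ψ
    ⟨*⟩-+ []       vs       Φ Ψ = refl
    ⟨*⟩-+ (k ∷ ws) []       Φ Ψ = refl
    ⟨*⟩-+ (k ∷ ws) (l ∷ vs) Φ Ψ = begin
      _ ≈⟨ +-cong (+-cong (+-cong (⟨*⟩-+ ws (l ∷ vs) (λ a → Φ (k ∷ a)) _) (⟨*⟩-+ (k ∷ ws) vs (λ a → Φ (l ∷ a)) _))
             (*-congˡ (⟨*⟩-+ ws vs (λ a → Φ (k +⁺ l ∷ a)) _)))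
             (*-congˡ (trans (⟨*⟩-cong ws vs λ { [] → sym (+-identityˡ 0#) ; (a₁ ∷ a) → refl })
                             (⟨*⟩-+ ws vs (onFirst λ a₁ a → Φ (k +⁺ l +⁺ a₁ ∷ a)) _))) ⟩
      _ ≈⟨ solve 10 (λ s r a b c d a′ b′ c′ d′ →
             (a :+ a′) :+ (b :+ b′) :+ s :* (c :+ c′) :+ r :* (d :+ d′) :=
             a :+ b :+ s :* c :+ r :* d :+ (a′ :+ b′ :+ s :* c′ :+ r :* d′)) refl s r _ _ _ _ _ _ _ _ ⟩
      _ ∎

    ⟨*⟩-scale : ∀ ws vs x Φ → ⟨ ws * vs ⟩ (λ a → x * Φ a) ≈ x * ⟨ ws * vs ⟩ Φ
    ⟨*⟩-scale []       vs       x Φ = refl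
    ⟨*⟩-scale (k ∷ ws) []       x Φ = refl
    ⟨*⟩-scale (k ∷ ws) (l ∷ vs) x Φ = begin
      _ ≈⟨ +-cong (+-cong (+-cong (⟨*⟩-scale ws (l ∷ vs) x _) (⟨*⟩-scale (k ∷ ws) vs x _))
             (*-congˡ (⟨*⟩-scale ws vs x _)))
             (*-congˡ (trans (⟨*⟩-cong ws vs λ { [] → sym (zeroʳ x) ; (a₁ ∷ a) → refl })
                             (⟨*⟩-scale ws vs x (onFirst λ a₁ a → Φ (k +⁺ l +⁺ a₁ ∷ a))))) ⟩
      _ ≈⟨ solve 7 (λ s r x a b c d →
             x :* a :+ x :* b :+ s :* (x :* c) :+ r :* (x :* d) :=
             x :* (a :+ b :+ s :* c :+ r :* d)) refl s r x _ _ _ _ ⟩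
      _ ∎

    ⟨*⟩-comm : ∀ ws vs Φ → ⟨ ws * vs ⟩ Φ ≈ ⟨ vs * ws ⟩ Φ
    ⟨*⟩-comm []       []       Φ = refl
    ⟨*⟩-comm []       (l ∷ vs) Φ = refl
    ⟨*⟩-comm (k ∷ ws) []       Φ = refl
    ⟨*⟩-comm (k ∷ ws) (l ∷ vs) Φ = +-cong (+-cong
      (trans (+-cong (⟨*⟩-comm ws (l ∷ vs) _) (⟨*⟩-comm (k ∷ ws) vs _)) (+-comm _ _))
      (*-congˡ (trans (⟨*⟩-comm ws vs _)
        (⟨*⟩-cong vs ws λ a → reflexive (≡.cong (λ x → Φ (x ∷ a)) k+l≡l+k)))))
      (*-congˡ (trans (⟨*⟩-comm ws vs _)
        (⟨*⟩-cong vs ws λ { [] → refl ; (a₁ ∷ a) →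
          reflexive (≡.cong (λ x → Φ (x +⁺ a₁ ∷ a)) k+l≡l+k) })))
      where
      k+l≡l+k : k +⁺ l ≡ l +⁺ k
      k+l≡l+k = ℕ≥-≡ (ℕ.+-comm (value k) (value l))

  -- Truncated sums: multiplicativity, and expansion into strict sums

  module TruncatedZeta
    (t s r : Carrier) (s+2t≈1 : s + (t + t) ≈ 1#) (r+t≈t² : r + t ≈ t * t)
    (w : ℕ → ℕ → Carrier) (w-+ : ∀ M k l → w M (k ℕ.+ l) ≈ w M k * w M l)
    where
    open Product s r

    -- Z M (k₁ ∷ ⋯ ∷ kₙ ∷ []) is the sum of t^e w(m₁,k₁) ⋯ w(mₙ,kₙ) over
    -- M > m₁ ≥ ⋯ ≥ mₙ ≥ 0, where e is the number of equalities; H M is the part with m₁ = M.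
    Z H : ℕ → List ℕ⁺ → Carrier
    Z M       []       = 1#
    Z zero    (k ∷ ks) = 0#
    Z (suc M) (k ∷ ks) = Z M (k ∷ ks) + H M (k ∷ ks)
    H M []       = 0#
    H M (k ∷ ks) = w M (value k) * (Z M ks + t * H M ks)

    Z-suc : ∀ M a → Z (suc M) a ≈ Z M a + H M a
    Z-suc M []      = sym (+-identityʳ 1#)
    Z-suc M (k ∷ a) = refl

    module _ (M : ℕ) (Z-* : ∀ ws vs → ⟨ ws * vs ⟩ (Z M) ≈ Z M ws * Z M vs) where

      private
        -- What (Z + H)(Z + H) has beyond Z Z: the pairs in which some leading variable equals M.
        crossTerms : List ℕ⁺ → List ℕ⁺ → Carrier
        crossTerms ws vs = H M ws * Z M vs + Z M ws * H M vs + H M ws * H M vs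

        -- Meant for Φ a = H M (k ∷ a), where x is the weight of k: once m₁ = M, the next variable
        -- is either smaller, or equal at the cost of a factor t.
        expand : ∀ ws vs x {Φ} → (∀ a → Φ a ≈ x * (Z M a + t * H M a)) →
          ⟨ ws * vs ⟩ (H M) ≈ crossTerms ws vs →
          ⟨ ws * vs ⟩ Φ ≈ x * (Z M ws * Z M vs + t * crossTerms ws vs)
        expand ws vs x {Φ} Φ≈ H-* = begin
          ⟨ ws * vs ⟩ Φ
            ≈⟨ ⟨*⟩-cong ws vs Φ≈ ⟩
          ⟨ ws * vs ⟩ (λ a → x * (Z M a + t * H M a))
            ≈⟨ ⟨*⟩-scale ws vs x _ ⟩
          x * ⟨ ws * vs ⟩ (λ a → Z M a + t * H M a)
            ≈⟨ *-congˡ (⟨*⟩-+ ws vs _ _) ⟩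
          x * (⟨ ws * vs ⟩ (Z M) + ⟨ ws * vs ⟩ (λ a → t * H M a))
            ≈⟨ *-congˡ (+-cong (Z-* ws vs) (trans (⟨*⟩-scale ws vs t _) (*-congˡ H-*))) ⟩
          x * (Z M ws * Z M vs + t * crossTerms ws vs) ∎

        -- For a = Z ws, b = H ws, c = Z vs, d = H vs, the coefficient of w k * w l.
        balance : ∀ a b c d →
            (t * ((a + b) * (c + t * d)) + t * ((a + t * b) * (c + d)))
          + s * (a * c + t * (b * c + a * d + b * d)) + r * (b * c + a * d + b * d)
          ≈ (a + t * b) * (c + t * d)
        balance a b c d = begin
          _ ≈⟨ solve 7 (λ t s r a b c d →
                 (t :* ((a :+ b) :* (c :+ t :* d)) :+ t :* ((a :+ t :* b) :* (c :+ d)))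
                 :+ s :* (a :* c :+ t :* (b :* c :+ a :* d :+ b :* d))
                 :+ r :* (b :* c :+ a :* d :+ b :* d) :=
                 s :* (a :* c :+ t :* (b :* c :+ a :* d :+ b :* d))
                 :+ (t :+ t) :* (a :* c) :+ (r :+ t) :* (b :* c :+ a :* d)
                 :+ t :* t :* (a :* d :+ b :* c :+ b :* d :+ b :* d) :+ r :* (b :* d))
                 refl t s r a b c d ⟩
          _ ≈⟨ +-congʳ (+-congʳ (+-congˡ (*-congʳ r+t≈t²))) ⟩
          _ ≈⟨ solve 7 (λ t s r a b c d →
                 s :* (a :* c :+ t :* (b :* c :+ a :* d :+ b :* d))
                 :+ (t :+ t) :* (a :* c) :+ t :* t :* (b :* c :+ a :* d)
                 :+ t :* t :* (a :* d :+ b :* c :+ b :* d :+ b :* d) :+ r :* (b :* d) :=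
                 (s :+ (t :+ t)) :* (a :* c :+ t :* (b :* c :+ a :* d :+ b :* d)) :+ r :* (b :* d))
                 refl t s r a b c d ⟩
          _ ≈⟨ +-congʳ (trans (*-congʳ s+2t≈1) (*-identityˡ _)) ⟩
          _ ≈⟨ solve 6 (λ t r a b c d →
                 a :* c :+ t :* (b :* c :+ a :* d :+ b :* d) :+ r :* (b :* d) :=
                 a :* c :+ t :* (b :* c :+ a :* d) :+ (r :+ t) :* (b :* d))
                 refl t r a b c d ⟩
          _ ≈⟨ +-congˡ (*-congʳ r+t≈t²) ⟩
          _ ≈⟨ solve 5 (λ t a b c d →
                 a :* c :+ t :* (b :* c :+ a :* d) :+ t :* t :* (b :* d) :=
                 (a :+ t :* b) :* (c :+ t :* d)) refl t a b c d ⟩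
          _ ∎

      -- `expand` evaluates the three terms of the product that prepend a letter, by `Z-*` at M and
      -- induction on the words. In the last term, adding k + l to the first letter multiplies `H M`
      -- by the weights of k and l.
      H-* : ∀ ws vs → ⟨ ws * vs ⟩ (H M) ≈ crossTerms ws vs
      H-* []       vs = begin
        H M vs                                     ≈⟨ *-identityˡ _ ⟨
        1# * H M vs                                ≈⟨ +-identityˡ _ ⟨
        0# + 1# * H M vs                           ≈⟨ +-identityʳ _ ⟨
        0# + 1# * H M vs + 0#                      ≈⟨ +-cong (+-congʳ (zeroˡ _)) (zeroˡ _) ⟨
        0# * Z M vs + 1# * H M vs + 0# * H M vs    ∎
      H-* (k ∷ ws) [] = begin
        h                        ≈⟨ *-identityʳ h ⟨
        h * 1#                   ≈⟨ +-identityʳ _ ⟨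
        h * 1# + 0#              ≈⟨ +-identityʳ _ ⟨
        h * 1# + 0# + 0#         ≈⟨ +-cong (+-congˡ (zeroʳ _)) (zeroʳ h) ⟨
        h * 1# + Z M (k ∷ ws) * 0# + h * 0# ∎
        where h = H M (k ∷ ws)
      H-* (k ∷ ws) (l ∷ vs) = begin
        _ ≈⟨ +-cong (+-cong (+-cong
               (expand ws (l ∷ vs) x (λ a → refl) (H-* ws (l ∷ vs)))
               (expand (k ∷ ws) vs y (λ a → refl) (H-* (k ∷ ws) vs)))
               (*-congˡ (expand ws vs (x * y) (λ a → *-congʳ (w-+ M (value k) (value l))) (H-* ws vs))))
               (*-congˡ (trans (⟨*⟩-cong ws vs λ { [] → sym (zeroʳ _) ; (a₁ ∷ a) → heads a₁ a })
                 (trans (⟨*⟩-scale ws vs (x * y) (H M)) (*-congˡ (H-* ws vs))))) ⟩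
        -- U and V are the values of `Z M` on the full words. The terms containing them already
        -- match two of the cross terms; the rest is x y times the left side of `balance`.
        _ ≈⟨ solve 11 (λ t s r x y a b c d U V →
               x :* (a :* V :+ t :* (b :* V :+ a :* (y :* (c :+ t :* d)) :+ b :* (y :* (c :+ t :* d))))
               :+ y :* (U :* c :+ t :* (x :* (a :+ t :* b) :* c :+ U :* d :+ x :* (a :+ t :* b) :* d))
               :+ s :* (x :* y :* (a :* c :+ t :* (b :* c :+ a :* d :+ b :* d)))
               :+ r :* (x :* y :* (b :* c :+ a :* d :+ b :* d)) :=
               x :* (a :+ t :* b) :* V :+ U :* (y :* (c :+ t :* d)) :+
               x :* y :* ((t :* ((a :+ b) :* (c :+ t :* d)) :+ t :* ((a :+ t :* b) :* (c :+ d)))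
                 :+ s :* (a :* c :+ t :* (b :* c :+ a :* d :+ b :* d)) :+ r :* (b :* c :+ a :* d :+ b :* d)))
               refl t s r x y (Z M ws) (H M ws) (Z M vs) (H M vs) (Z M (k ∷ ws)) (Z M (l ∷ vs)) ⟩
        _ ≈⟨ +-congˡ (*-congˡ (balance (Z M ws) (H M ws) (Z M vs) (H M vs))) ⟩
        _ ≈⟨ +-congˡ (solve 4 (λ x y e f → x :* y :* (e :* f) := x :* e :* (y :* f)) refl
               x y (Z M ws + t * H M ws) (Z M vs + t * H M vs)) ⟩
        _ ∎
        where
        x = w M (value k)
        y = w M (value l)
        heads : ∀ a₁ a → H M (k +⁺ l +⁺ a₁ ∷ a) ≈ x * y * H M (a₁ ∷ a)
        heads a₁ a = trans (*-congʳ (trans (w-+ M (value k ℕ.+ value l) (value a₁))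
          (*-congʳ (w-+ M (value k) (value l))))) (*-assoc _ _ _)

    -- Every term in the product of two nonempty words is a nonempty word, and `Z 0` vanishes on
    -- those.
    Z₀-* : ∀ ws vs → ⟨ ws * vs ⟩ (Z 0) ≈ Z 0 ws * Z 0 vs
    Z₀-* []       vs       = sym (*-identityˡ _)
    Z₀-* (k ∷ ws) []       = sym (*-identityʳ _)
    Z₀-* (k ∷ ws) (l ∷ vs) = begin
      _ ≈⟨ +-cong (+-cong (+-cong (vanish ws (l ∷ vs) λ _ → refl) (vanish (k ∷ ws) vs λ _ → refl))
             (*-congˡ (vanish ws vs λ _ → refl)))
             (*-congˡ (vanish ws vs λ { [] → refl ; (_ ∷ _) → refl })) ⟩
      0# + 0# + s * 0# + r * 0# ≈⟨ +-cong (+-cong (+-identityˡ 0#) (zeroʳ s)) (zeroʳ r) ⟩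
      0# + 0# + 0#              ≈⟨ trans (+-identityʳ _) (+-identityʳ 0#) ⟩
      0#                        ≈⟨ zeroˡ 0# ⟨
      0# * 0#                   ∎
      where
      vanish : ∀ ws vs {Φ} → (∀ a → Φ a ≈ 0#) → ⟨ ws * vs ⟩ Φ ≈ 0#
      vanish ws vs Φ≈0 = trans (⟨*⟩-cong ws vs (λ a → trans (Φ≈0 a) (sym (zeroˡ 0#))))
        (trans (⟨*⟩-scale ws vs 0# (λ _ → 0#)) (zeroˡ _))

    Z-* : ∀ M ws vs → ⟨ ws * vs ⟩ (Z M) ≈ Z M ws * Z M vs
    Z-* zero    ws vs = Z₀-* ws vs
    Z-* (suc M) ws vs = begin
      ⟨ ws * vs ⟩ (Z (suc M))                   ≈⟨ ⟨*⟩-cong ws vs (Z-suc M) ⟩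
      ⟨ ws * vs ⟩ (λ a → Z M a + H M a)         ≈⟨ ⟨*⟩-+ ws vs _ _ ⟩
      ⟨ ws * vs ⟩ (Z M) + ⟨ ws * vs ⟩ (H M)     ≈⟨ +-cong (Z-* M ws vs) (H-* M (Z-* M) ws vs) ⟩
      _ ≈⟨ solve 4 (λ a b c d → a :* c :+ (b :* c :+ a :* d :+ b :* d) := (a :+ b) :* (c :+ d))
             refl (Z M ws) (H M ws) (Z M vs) (H M vs) ⟩
      (Z M ws + H M ws) * (Z M vs + H M vs)     ≈⟨ *-cong (Z-suc M ws) (Z-suc M vs) ⟨
      Z (suc M) ws * Z (suc M) vs               ∎

    -- Y is Z restricted to m₁ > ⋯ > mₙ.
    mutual
      Y : ℕ → List ℕ⁺ → Carrier
      Y M []       = 1#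
      Y M (k ∷ ks) = Y∷ M (value k) ks

      Y∷ : ℕ → ℕ → List ℕ⁺ → Carrier
      Y∷ zero    k ks = 0#
      Y∷ (suc M) k ks = Y∷ M k ks + w M k * Y M ks

    -- The sum defining ζᵗ with G in place of ζ. The bound b stays free: ζᵗ has b = 2, while a comma
    -- in `merges` leads to b = 1.
    merged : (ℕ → List ℕ⁺ → Carrier) → ∀ {b} → ℕ≥ b → List ℕ⁺ → Carrier
    merged G k ks = sumOver (merges k ks) λ q →
      t ^ (suc (length ks) ∸ dep q) * G (value (proj₁ q)) (proj₂ q)

    Z∷ : ℕ → ℕ → List ℕ⁺ → Carrier
    Z∷ zero    k ks = 0#
    Z∷ (suc M) k ks = Z∷ M k ks + w M k * (Z M ks + t * H M ks)

    Z≈Z∷ : ∀ M k ks → Z M (k ∷ ks) ≈ Z∷ M (value k) ks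
    Z≈Z∷ zero    k ks = refl
    Z≈Z∷ (suc M) k ks = +-congʳ (Z≈Z∷ M k ks)

    -- A comma after the leading entry makes the second variable smaller than M, which is the case
    -- of `merged-Y` at M. A plus makes it equal to M and costs a factor t, leaving a shorter index.
    merged-H : ∀ M → (∀ {b} (k : ℕ≥ b) ks → merged (Y∷ M) k ks ≈ Z∷ M (value k) ks) →
      ∀ {b} (k : ℕ≥ b) ks →
      merged (λ k ks → w M k * Y M ks) k ks ≈ w M (value k) * (Z M ks + t * H M ks)
    merged-H M merged-Y k [] = begin
      1# * (w M (value k) * 1#) + 0# ≈⟨ +-identityʳ _ ⟩
      1# * (w M (value k) * 1#)      ≈⟨ *-identityˡ _ ⟩
      w M (value k) * 1#             ≈⟨ *-congˡ (trans (+-congˡ (zeroʳ t)) (+-identityʳ 1#)) ⟨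
      w M (value k) * (1# + t * 0#)  ∎
    merged-H M merged-Y k (k₂ ∷ ks) = begin
      _ ≈⟨ sumOver-++ (map _ (merges k₂ ks)) _ _ ⟩
      _ ≈⟨ +-cong comma plus ⟩
      x * Z M (k₂ ∷ ks) + t * (x * H M (k₂ ∷ ks))
        ≈⟨ solve 4 (λ x z t h → x :* z :+ t :* (x :* h) := x :* (z :+ t :* h)) refl x _ t _ ⟩
      x * (Z M (k₂ ∷ ks) + t * H M (k₂ ∷ ks)) ∎
      where
      n = suc (length ks)
      x = w M (value k)
      F : ∀ {b} → Index b → Carrier
      F q = t ^ (suc n ∸ dep q) * (w M (value (proj₁ q)) * Y M (proj₂ q))
      comma : sumOver (map (λ (l , ls) → k , l ∷ ls) (merges k₂ ks)) F ≈ x * Z M (k₂ ∷ ks)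
      comma = begin
        _ ≡⟨ sumOver-map _ (merges k₂ ks) F ⟩
        _ ≈⟨ sumOver-cong (merges k₂ ks) (λ q → *-exchange (t ^ (n ∸ dep q)) x _) ⟩
        _ ≈⟨ sumOver-scale (merges k₂ ks) x _ ⟩
        x * merged (Y∷ M) k₂ ks ≈⟨ *-congˡ (merged-Y k₂ ks) ⟩
        x * Z∷ M (value k₂) ks  ≈⟨ *-congˡ (Z≈Z∷ M k₂ ks) ⟨
        x * Z M (k₂ ∷ ks)       ∎
      plus : sumOver (merges (k +⁺ k₂) ks) F ≈ t * (x * H M (k₂ ∷ ks))
      plus = begin
        _ ≈⟨ sumOver-cong-All (All.map (λ q≤n → trans
               (*-congʳ (reflexive (≡.cong (t ^_) (ℕ.+-∸-assoc 1 q≤n)))) (*-assoc t _ _))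
               (merges-dep (k +⁺ k₂) ks)) ⟩
        _ ≈⟨ sumOver-scale (merges (k +⁺ k₂) ks) t _ ⟩
        t * merged (λ k ks → w M k * Y M ks) (k +⁺ k₂) ks
          ≈⟨ *-congˡ (merged-H M merged-Y (k +⁺ k₂) ks) ⟩
        t * (w M (value k ℕ.+ value k₂) * (Z M ks + t * H M ks))
          ≈⟨ *-congˡ (trans (*-congʳ (w-+ M (value k) (value k₂))) (*-assoc x _ _)) ⟩
        t * (x * H M (k₂ ∷ ks)) ∎

    -- Runs of equal variables in m₁ ≥ ⋯ ≥ mₙ correspond to merged entries, and the number of
    -- equalities is the loss of depth. The induction splits off the case of maximal m₁.
    merged-Y : ∀ M {b} (k : ℕ≥ b) ks → merged (Y∷ M) k ks ≈ Z∷ M (value k) ks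
    merged-Y zero    k ks = trans (sumOver-cong (merges k ks) (λ q → *-comm _ 0#))
      (trans (sumOver-scale (merges k ks) 0# (λ q → t ^ (suc (length ks) ∸ dep q))) (zeroˡ _))
    merged-Y (suc M) k ks = begin
      _ ≈⟨ sumOver-cong (merges k ks) (λ q → distribˡ _ _ _) ⟩
      _ ≈⟨ sumOver-+ (merges k ks) _ _ ⟩
      merged (Y∷ M) k ks + merged (λ k ks → w M k * Y M ks) k ks
        ≈⟨ +-cong (merged-Y M k ks) (merged-H M (merged-Y M) k ks) ⟩
      Z∷ (suc M) (value k) ks ∎

  private
    x-y+y≈x : ∀ x y → x - y + y ≈ x
    x-y+y≈x x y = trans (+-assoc x (- y) y) (trans (+-congˡ (-‿inverseˡ y)) (+-identityʳ x))

  1-2x+2x≈1 : ∀ x → (1# - 2 × x) + (x + x) ≈ 1#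
  1-2x+2x≈1 x = trans (+-congˡ (+-congˡ (sym (+-identityʳ x)))) (x-y+y≈x 1# (2 × x))

  x²-x+x≈x² : ∀ x → (x ^ 2 - x) + x ≈ x * x
  x²-x+x≈x² x = trans (x-y+y≈x (x ^ 2) x) (*-congˡ (*-identityʳ x))

  x≈0⇒[1-x]y≈y : ∀ x y → x ≈ 0# → (1# - x) * y ≈ y
  x≈0⇒[1-x]y≈y x y x≈0 = trans (*-congʳ (trans (+-congˡ (-‿cong x≈0))
    (trans (sym (+-identityʳ _)) (x-y+y≈x 1# 0#)))) (*-identityˡ y)

  -- Products of powers of a single letter

  module Power (s r : Carrier) (p : ℕ⁺) where
    open Product s r
    open Words p

    private
      Functional = List ℕ⁺ → Carrier

      by-p by-2p raise : Functional → Functional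
      by-p  Φ a = Φ (p ∷ a)
      by-2p Φ a = Φ (p +⁺ p ∷ a)
      raise Φ   = onFirst λ a₁ a → Φ (p +⁺ p +⁺ a₁ ∷ a)

      sumWords : ℕ → ℕ → ℕ → Functional → Carrier
      sumWords o i e = sumOver (words 0 o i e)

      -- Indexed with i and e first, so that it reduces to 0# as soon as one of them is positive.
      empty : ℕ → ℕ → ℕ → ℕ → Functional → Carrier
      empty zero zero zero zero Φ = Φ []
      empty _    _    _    _    Φ = 0#

      mutual
        -- Adding 2p to the first letter carries the nonempty words of `words d o i e` onto
        -- `words (2 + d) o i e`; `raise` sends the empty word, present only for d = 0, to 0.
        sum-raise : ∀ d o i e Φ →
          sumOver (words (2 ℕ.+ d) o i e) Φ ≈ sumOver (words d o i e) (raise Φ)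
        sum-raise d o i e Φ = begin
          sumOver (words (2 ℕ.+ d) o i e) Φ
            ≈⟨ split₃ (odd (2 ℕ.+ d) o i e) (even (2 ℕ.+ d) o i e) Φ ⟩
          _ ≈⟨ +-cong (sum-raise-odd d o i e Φ) (+-cong (sum-raise-even d o i e Φ) (sum-raise-larger d o i e Φ)) ⟩
          _ ≈⟨ split₃ (odd d o i e) (even d o i e) (raise Φ) ⟨
          sumOver (odd d o i e ++ even d o i e ++ larger d o i e) (raise Φ)
            ≈⟨ +-identityˡ _ ⟨
          0# + sumOver (odd d o i e ++ even d o i e ++ larger d o i e) (raise Φ)
            ≈⟨ +-congʳ (raise-none d o i e Φ) ⟨
          sumOver (none d o i e) (raise Φ) + sumOver (odd d o i e ++ even d o i e ++ larger d o i e) (raise Φ)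
            ≈⟨ sumOver-++ (none d o i e) _ (raise Φ) ⟨
          sumOver (words d o i e) (raise Φ) ∎

        split₃ : ∀ (xs ys : List (List ℕ⁺)) {zs} Φ →
          sumOver (xs ++ ys ++ zs) Φ ≈ sumOver xs Φ + (sumOver ys Φ + sumOver zs Φ)
        split₃ xs ys Φ = trans (sumOver-++ xs _ Φ) (+-congˡ (sumOver-++ ys _ Φ))

        raise-none : ∀ d o i e Φ → sumOver (none d o i e) (raise Φ) ≈ 0#
        raise-none zero    zero    zero    zero    Φ = +-identityˡ 0#
        raise-none zero    zero    zero    (suc e) Φ = refl
        raise-none zero    zero    (suc i) e       Φ = refl
        raise-none zero    (suc o) i       e       Φ = refl
        raise-none (suc d) o       i       e       Φ = refl

        raise-first : ∀ d Φ a → Φ (multiple p (2 ℕ.+ d) ∷ a) ≈ raise Φ (multiple p d ∷ a)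
        raise-first d Φ a = reflexive (≡.cong (λ x → Φ (x ∷ a))
          (ℕ≥-≡ (≡.sym (ℕ.+-assoc (value p) (value p) (suc d ℕ.* value p)))))

        sum-raise-odd : ∀ d o i e Φ →
          sumOver (odd (2 ℕ.+ d) o i e) Φ ≈ sumOver (odd d o i e) (raise Φ)
        sum-raise-odd d zero    i e Φ = refl
        sum-raise-odd d (suc o) i e Φ = begin
          _ ≡⟨ sumOver-map _ (words 0 o i e) Φ ⟩
          _ ≈⟨ sumOver-cong (words 0 o i e) (raise-first d Φ) ⟩
          _ ≡⟨ sumOver-map _ (words 0 o i e) (raise Φ) ⟨
          _ ∎

        sum-raise-even : ∀ d o i e Φ →
          sumOver (even (2 ℕ.+ d) o i e) Φ ≈ sumOver (even d o i e) (raise Φ)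
        sum-raise-even d o i zero    Φ = refl
        sum-raise-even d o i (suc e) Φ = begin
          _ ≡⟨ sumOver-map _ (words 0 o i e) Φ ⟩
          _ ≈⟨ sumOver-cong (words 0 o i e) (raise-first (suc d) Φ) ⟩
          _ ≡⟨ sumOver-map _ (words 0 o i e) (raise Φ) ⟨
          _ ∎

        sum-raise-larger : ∀ d o i e Φ →
          sumOver (larger (2 ℕ.+ d) o i e) Φ ≈ sumOver (larger d o i e) (raise Φ)
        sum-raise-larger d o zero    e Φ = refl
        sum-raise-larger d o (suc i) e Φ = sum-raise (2 ℕ.+ d) o i e Φ

      -- Here x and y are what remains of the exponents of X and Y after division by (XY)^(i+e). So
      -- x + y is the number of odd letters, and the binomial coefficient counts the choices of X or
      -- Y at them.
      weight : ℕ → ℕ → ℕ → ℕ → Carrier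
      weight x y i e = ((x ℕ.+ y) C x) × (r ^ i * s ^ e)

      term : ℕ → ℕ → ℕ → ℕ → Functional → Carrier
      term i e x y Φ = weight x y i e * sumWords (x ℕ.+ y) i e Φ

      -- The value at n - 1, read as 0 for n = 0, so that recurrences need no separate boundary
      -- cases.
      down : (ℕ → Functional → Carrier) → ℕ → Functional → Carrier
      down f zero    Φ = 0#
      down f (suc n) Φ = f n Φ

      nC0≡1 : ∀ n → n C 0 ≡ 1
      nC0≡1 n = ≡.trans (nCk≡nC[n∸k] {0} {n} ℕ.z≤n) (nCn≡1 n)

      odd-suc : ∀ o i e Φ → sumOver (odd 0 (suc o) i e) Φ ≈ sumWords o i e (by-p Φ)
      odd-suc o i e Φ = trans (reflexive (sumOver-map _ (words 0 o i e) Φ))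
        (sumOver-cong (words 0 o i e) λ a →
          reflexive (≡.cong (λ x → Φ (x ∷ a)) (ℕ≥-≡ (ℕ.*-identityˡ (value p)))))

      even-suc : ∀ o i e Φ → sumOver (even 0 o i (suc e)) Φ ≈ sumWords o i e (by-2p Φ)
      even-suc o i e Φ = trans (reflexive (sumOver-map _ (words 0 o i e) Φ))
        (sumOver-cong (words 0 o i e) λ a →
          reflexive (≡.cong (λ x → Φ (x ∷ a)) (ℕ≥-≡ (≡.cong (value p ℕ.+_) (ℕ.*-identityˡ (value p))))))

      -- A first letter p carries the factor X + Y, which on coefficients is Pascal's rule. For x =
      -- 0 or y = 0 one of its summands is missing and the two binomials involved are 1.
      term-odd : ∀ i e x y Φ →
        weight x y i e * sumOver (odd 0 (x ℕ.+ y) i e) Φ ≈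
        down (λ x′ → term i e x′ y) x (by-p Φ) + down (λ y′ → term i e x y′) y (by-p Φ)
      term-odd i e zero zero Φ = trans (zeroʳ _) (sym (+-identityˡ 0#))
      term-odd i e zero (suc y) Φ = trans
        (*-cong (×-congˡ (≡.trans (nC0≡1 (suc y)) (≡.sym (nC0≡1 y)))) (odd-suc y i e Φ))
        (sym (+-identityˡ _))
      term-odd i e (suc x) zero Φ = trans
        (*-cong (×-congˡ eq) (odd-suc (x ℕ.+ 0) i e Φ))
        (sym (+-identityʳ _))
        where
        one : ∀ n → (n ℕ.+ 0) C n ≡ 1
        one n = ≡.trans (≡.cong (_C n) (ℕ.+-identityʳ n)) (nCn≡1 n)
        eq : (suc x ℕ.+ 0) C suc x ≡ (x ℕ.+ 0) C x
        eq = ≡.trans (one (suc x)) (≡.sym (one x))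
      term-odd i e (suc x) (suc y) Φ = begin
        (suc n C suc x) × z * sumOver (odd 0 (suc n) i e) Φ
          ≈⟨ *-cong (×-congˡ (≡.sym (nCk+nC[k+1]≡[n+1]C[k+1] n x))) (odd-suc n i e Φ) ⟩
        (n C x ℕ.+ n C suc x) × z * sumWords n i e (by-p Φ)
          ≈⟨ *-congʳ (×-homo-+ z (n C x) (n C suc x)) ⟩
        ((n C x) × z + (n C suc x) × z) * sumWords n i e (by-p Φ)
          ≈⟨ distribʳ _ _ _ ⟩
        (n C x) × z * sumWords n i e (by-p Φ) + (n C suc x) × z * sumWords n i e (by-p Φ)
          -- Only the second summand is rewritten: there the number of odd letters has to read
          -- `suc x + y`.
          ≡⟨ ≡.cong (λ n′ → (n C x) × z * sumWords n i e (by-p Φ) + (n′ C suc x) × z * sumWords n′ i e (by-p Φ)) (ℕ.+-suc x y) ⟩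
        term i e x (suc y) (by-p Φ) + term i e (suc x) y (by-p Φ) ∎
        where
        n = x ℕ.+ suc y
        z = r ^ i * s ^ e

      term-even : ∀ i e x y Φ →
        weight x y i e * sumOver (even 0 (x ℕ.+ y) i e) Φ ≈
        s * down (λ e′ → term i e′ x y) e (by-2p Φ)
      term-even i zero    x y Φ = trans (zeroʳ _) (sym (zeroʳ s))
      term-even i (suc e) x y Φ = begin
        (c₀ × (r ^ i * (s * s ^ e))) * sumOver (even 0 (x ℕ.+ y) i (suc e)) Φ
          ≈⟨ *-cong (×-congʳ c₀ (*-exchange (r ^ i) s (s ^ e))) (even-suc (x ℕ.+ y) i e Φ) ⟩
        (c₀ × (s * (r ^ i * s ^ e))) * sumWords (x ℕ.+ y) i e (by-2p Φ)
          ≈⟨ *-congʳ (×-comm-* c₀ s _) ⟨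
        s * (c₀ × (r ^ i * s ^ e)) * sumWords (x ℕ.+ y) i e (by-2p Φ)
          ≈⟨ *-assoc _ _ _ ⟩
        s * term i e x y (by-2p Φ) ∎
        where c₀ = (x ℕ.+ y) C x

      term-larger : ∀ i e x y Φ →
        weight x y i e * sumOver (larger 0 (x ℕ.+ y) i e) Φ ≈
        r * down (λ i′ → term i′ e x y) i (raise Φ)
      term-larger zero    e x y Φ = trans (zeroʳ _) (sym (zeroʳ r))
      term-larger (suc i) e x y Φ = begin
        (c₀ × (r * r ^ i * s ^ e)) * sumOver (words 2 (x ℕ.+ y) i e) Φ
          ≈⟨ *-cong (×-congʳ c₀ (*-assoc r (r ^ i) (s ^ e))) (sum-raise 0 (x ℕ.+ y) i e Φ) ⟩
        (c₀ × (r * (r ^ i * s ^ e))) * sumWords (x ℕ.+ y) i e (raise Φ)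
          ≈⟨ *-congʳ (×-comm-* c₀ r _) ⟨
        r * (c₀ × (r ^ i * s ^ e)) * sumWords (x ℕ.+ y) i e (raise Φ)
          ≈⟨ *-assoc _ _ _ ⟩
        r * term i e x y (raise Φ) ∎
        where c₀ = (x ℕ.+ y) C x

      term-empty : ∀ i e x y Φ →
        weight x y i e * sumOver (none 0 (x ℕ.+ y) i e) Φ ≈ empty i e x y Φ
      term-empty zero zero zero zero Φ = begin
        (1 × (1# * 1#)) * (Φ [] + 0#) ≈⟨ *-cong (trans (×-homo-1 _) (*-identityˡ 1#)) (+-identityʳ _) ⟩
        1# * Φ []                     ≈⟨ *-identityˡ _ ⟩
        Φ []                          ∎
      term-empty zero    zero    zero    (suc y) Φ = zeroʳ _
      term-empty zero    zero    (suc x) y       Φ = zeroʳ _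
      term-empty zero    (suc e) zero    zero    Φ = zeroʳ _
      term-empty zero    (suc e) zero    (suc y) Φ = zeroʳ _
      term-empty zero    (suc e) (suc x) y       Φ = zeroʳ _
      term-empty (suc i) e       zero    zero    Φ = zeroʳ _
      term-empty (suc i) e       zero    (suc y) Φ = zeroʳ _
      term-empty (suc i) e       (suc x) y       Φ = zeroʳ _

      -- The equation for G, one coefficient at a time. A factor XY is absorbed by lowering i or e,
      -- while x and y stay fixed.
      term-rec : ∀ i e x y Φ → term i e x y Φ ≈
          empty i e x y Φ
        + (down (λ x′ → term i e x′ y) x (by-p Φ) + down (λ y′ → term i e x y′) y (by-p Φ))
        + s * down (λ e′ → term i e′ x y) e (by-2p Φ)
        + r * down (λ i′ → term i′ e x y) i (raise Φ)
      term-rec i e x y Φ = begin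
        c₀ * sumWords o i e Φ
          ≈⟨ *-congˡ (trans (sumOver-++ (none 0 o i e) _ Φ) (+-congˡ (split₃ (odd 0 o i e) (even 0 o i e) Φ))) ⟩
        c₀ * (sumOver (none 0 o i e) Φ + (sumOver (odd 0 o i e) Φ + (sumOver (even 0 o i e) Φ + sumOver (larger 0 o i e) Φ)))
          ≈⟨ solve 5 (λ c a b d f → c :* (a :+ (b :+ (d :+ f))) := c :* a :+ c :* b :+ c :* d :+ c :* f) refl c₀ _ _ _ _ ⟩
        _ ≈⟨ +-cong (+-cong (+-cong (term-empty i e x y Φ) (term-odd i e x y Φ)) (term-even i e x y Φ)) (term-larger i e x y Φ) ⟩
        _ ∎
        where
        o  = x ℕ.+ y
        c₀ = weight x y i e

      level : ℕ → ℕ → ℕ → Functional → Carrier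
      level k x y Φ = antidiagonalSum k λ i e → term i e x y Φ

      downSum-+ : ∀ k x y Φ →
        antidiagonalSum k (λ i e → down (λ x′ → term i e x′ y) x Φ + down (λ y′ → term i e x y′) y Φ)
        ≈ down (λ x′ → level k x′ y) x Φ + down (λ y′ → level k x y′) y Φ
      downSum-+ k x y Φ = trans
        (antidiagonalSum-+ k (λ i e → down (λ x′ → term i e x′ y) x Φ) (λ i e → down (λ y′ → term i e x y′) y Φ))
        (+-cong (left x) (right y))
        where
        left : ∀ x → antidiagonalSum k (λ i e → down (λ x′ → term i e x′ y) x Φ) ≈
                     down (λ x′ → level k x′ y) x Φ
        left zero    = sum<-zero (suc k)
        left (suc x) = refl
        right : ∀ y → antidiagonalSum k (λ i e → down (λ y′ → term i e x y′) y Φ) ≈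
                      down (λ y′ → level k x y′) y Φ
        right zero    = sum<-zero (suc k)
        right (suc y) = refl

      level-rec-zero : ∀ x y Φ → level 0 x y Φ ≈
        empty 0 0 x y Φ + (down (λ x′ → level 0 x′ y) x (by-p Φ) + down (λ y′ → level 0 x y′) y (by-p Φ))
      level-rec-zero x y Φ = begin
        term 0 0 x y Φ + 0# ≈⟨ +-identityʳ _ ⟩
        term 0 0 x y Φ      ≈⟨ term-rec 0 0 x y Φ ⟩
        _                   ≈⟨ +-cong (+-congˡ (zeroʳ s)) (zeroʳ r) ⟩
        _                   ≈⟨ trans (+-identityʳ _) (+-identityʳ _) ⟩
        _                   ≈⟨ +-congˡ (sym (+-identityʳ _)) ⟩
        _                   ≈⟨ +-congˡ (downSum-+ 0 x y (by-p Φ)) ⟩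
        _                   ∎

      level-rec-suc : ∀ k x y Φ → level (suc k) x y Φ ≈
          (down (λ x′ → level (suc k) x′ y) x (by-p Φ) + down (λ y′ → level (suc k) x y′) y (by-p Φ))
        + s * level k x y (by-2p Φ)
        + r * level k x y (raise Φ)
      level-rec-suc k x y Φ = begin
        level (suc k) x y Φ
          ≈⟨ antidiagonalSum-cong (suc k) (λ i e → term-rec i e x y Φ) ⟩
        antidiagonalSum (suc k) (λ i e → empt i e + odds i e + s * evens i e + r * largers i e)
          ≈⟨ antidiagonalSum-+ (suc k) (λ i e → empt i e + odds i e + s * evens i e) (λ i e → r * largers i e) ⟩
        _ ≈⟨ +-congʳ (antidiagonalSum-+ (suc k) (λ i e → empt i e + odds i e) (λ i e → s * evens i e)) ⟩
        _ ≈⟨ +-congʳ (+-congʳ (antidiagonalSum-+ (suc k) empt odds)) ⟩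
        _ ≈⟨ +-cong (+-cong (+-cong sum-empt (downSum-+ (suc k) x y (by-p Φ))) sum-evens) sum-largers ⟩
        _ ≈⟨ +-congʳ (+-congʳ (+-identityˡ _)) ⟩
        _ ∎
        where
        empt odds evens largers : ℕ → ℕ → Carrier
        empt    i e = empty i e x y Φ
        odds    i e = down (λ x′ → term i e x′ y) x (by-p Φ) + down (λ y′ → term i e x y′) y (by-p Φ)
        evens   i e = down (λ e′ → term i e′ x y) e (by-2p Φ)
        largers i e = down (λ i′ → term i′ e x y) i (raise Φ)
        sum-empt : antidiagonalSum (suc k) empt ≈ 0#
        sum-empt = trans (+-identityˡ _) (sum<-zero (suc k))
        sum-evens : antidiagonalSum (suc k) (λ i e → s * evens i e) ≈ s * level k x y (by-2p Φ)
        -- The vanishing summand e = 0 is the last one of the antidiagonal; for `sum-largers` the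
        -- vanishing i = 0 is the first.
        sum-evens = trans (antidiagonalSum-scale (suc k) s evens) (*-congˡ
          (trans (antidiagonalSum-suc k evens) (+-identityʳ _)))
        sum-largers : antidiagonalSum (suc k) (λ i e → r * largers i e) ≈ r * level k x y (raise Φ)
        sum-largers = trans (antidiagonalSum-scale (suc k) r largers) (*-congˡ (+-identityˡ _))

      -- The contribution to the coefficient of X^(x+k) Y^(y+k) from words with i + e ≥ k;
      -- `level k x y` is the part with i + e = k.
      diagonal : ℕ → ℕ → ℕ → Functional → Carrier
      diagonal k zero    y       Φ = level k zero y Φ
      diagonal k (suc x) zero    Φ = level k (suc x) zero Φ
      diagonal k (suc x) (suc y) Φ = level k (suc x) (suc y) Φ + diagonal (suc k) x y Φ

      diagonal-zeroʳ : ∀ k x Φ → diagonal k x 0 Φ ≈ level k x 0 Φ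
      diagonal-zeroʳ k zero    Φ = refl
      diagonal-zeroʳ k (suc x) Φ = refl

      diagonal-sucʳ : ∀ k x y Φ →
        diagonal k x (suc y) Φ ≈ level k x (suc y) Φ + down (λ x′ → diagonal (suc k) x′ y) x Φ
      diagonal-sucʳ k zero    y Φ = sym (+-identityʳ _)
      diagonal-sucʳ k (suc x) y Φ = refl

      diagonal-sucˡ : ∀ k x y Φ →
        diagonal k (suc x) y Φ ≈ level k (suc x) y Φ + down (λ y′ → diagonal (suc k) x y′) y Φ
      diagonal-sucˡ k x zero    Φ = sym (+-identityʳ _)
      diagonal-sucˡ k x (suc y) Φ = refl

      diagonal-rec : ∀ k x y Φ → diagonal (suc k) x y Φ ≈
          (down (λ x′ → diagonal (suc k) x′ y) x (by-p Φ) + down (λ y′ → diagonal (suc k) x y′) y (by-p Φ))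
        + s * diagonal k x y (by-2p Φ)
        + r * diagonal k x y (raise Φ)
      diagonal-rec k zero    zero    Φ = level-rec-suc k 0 0 Φ
      diagonal-rec k zero    (suc y) Φ = level-rec-suc k 0 (suc y) Φ
      diagonal-rec k (suc x) zero    Φ = trans (level-rec-suc k (suc x) 0 Φ)
        (+-congʳ (+-congʳ (+-congʳ (sym (diagonal-zeroʳ (suc k) x (by-p Φ))))))
      diagonal-rec k (suc x) (suc y) Φ = begin
        level (suc k) (suc x) (suc y) Φ + diagonal (2 ℕ.+ k) x y Φ
          ≈⟨ +-cong (level-rec-suc k (suc x) (suc y) Φ) (diagonal-rec (suc k) x y Φ) ⟩
        _ ≈⟨ solve 10 (λ s r a b c d a′ b′ c′ d′ →
               (a :+ b) :+ s :* c :+ r :* d :+ ((a′ :+ b′) :+ s :* c′ :+ r :* d′) :=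
               ((a :+ a′) :+ (b :+ b′)) :+ s :* (c :+ c′) :+ r :* (d :+ d′)) refl s r _ _ _ _ _ _ _ _ ⟩
        _ ≈⟨ +-congʳ (+-congʳ (+-cong (diagonal-sucʳ (suc k) x y (by-p Φ)) (diagonal-sucˡ (suc k) x y (by-p Φ)))) ⟨
        _ ∎

      -- At level 0 all letters are p, so the terms with s and r come from the diagonal starting at
      -- 1. The outcome is the recursion that defines the product of {p}^(x+1) and {p}^(y+1).
      diagonal-rec-zero : ∀ x y Φ → diagonal 0 (suc x) (suc y) Φ ≈
          diagonal 0 x (suc y) (by-p Φ) + diagonal 0 (suc x) y (by-p Φ)
        + s * diagonal 0 x y (by-2p Φ)
        + r * diagonal 0 x y (raise Φ)
      diagonal-rec-zero x y Φ = begin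
        level 0 (suc x) (suc y) Φ + diagonal 1 x y Φ
          ≈⟨ +-cong (trans (level-rec-zero (suc x) (suc y) Φ) (+-identityˡ _)) (diagonal-rec 0 x y Φ) ⟩
        _ ≈⟨ solve 8 (λ s r a b a′ b′ c d →
               (a :+ b) :+ ((a′ :+ b′) :+ s :* c :+ r :* d) :=
               ((a :+ a′) :+ (b :+ b′)) :+ s :* c :+ r :* d) refl s r _ _ _ _ _ _ ⟩
        _ ≈⟨ +-congʳ (+-congʳ (+-cong (diagonal-sucʳ 0 x y (by-p Φ)) (diagonal-sucˡ 0 x y (by-p Φ)))) ⟨
        _ ∎

      power-zeroˡ : ∀ y Φ → Φ (replicate y p) ≈ level 0 0 y Φ
      power-zeroˡ zero    Φ = sym (trans (level-rec-zero 0 0 Φ)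
        (trans (+-congˡ (+-identityˡ 0#)) (+-identityʳ _)))
      power-zeroˡ (suc y) Φ = trans (power-zeroˡ y (by-p Φ)) (sym (trans (level-rec-zero 0 (suc y) Φ)
        (trans (+-identityˡ _) (+-identityˡ _))))

      power-zeroʳ : ∀ x Φ → Φ (replicate x p) ≈ level 0 x 0 Φ
      power-zeroʳ zero    Φ = power-zeroˡ 0 Φ
      power-zeroʳ (suc x) Φ = trans (power-zeroʳ x (by-p Φ)) (sym (trans (level-rec-zero (suc x) 0 Φ)
        (trans (+-identityˡ _) (+-identityʳ _))))

      power-diagonal : ∀ x y Φ → ⟨ replicate x p * replicate y p ⟩ Φ ≈ diagonal 0 x y Φ
      power-diagonal zero    y       Φ = power-zeroˡ y Φ
      power-diagonal (suc x) zero    Φ = power-zeroʳ (suc x) Φ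
      power-diagonal (suc x) (suc y) Φ = trans
        (+-cong (+-cong (+-cong (power-diagonal x (suc y) (by-p Φ)) (power-diagonal (suc x) y (by-p Φ)))
          (*-congˡ (power-diagonal x y (by-2p Φ)))) (*-congˡ (power-diagonal x y (raise Φ))))
        (sym (diagonal-rec-zero x y Φ))

      diagonal-sum : ∀ k x y Φ →
        diagonal k x y Φ ≈ sum< (suc (x ⊓ y)) λ j → level (j ℕ.+ k) (x ∸ j) (y ∸ j) Φ
      diagonal-sum k zero    y       Φ = sym (+-identityʳ _)
      diagonal-sum k (suc x) zero    Φ = sym (+-identityʳ _)
      diagonal-sum k (suc x) (suc y) Φ = +-congˡ (trans (diagonal-sum (suc k) x y Φ)
        (sum<-cong (suc (x ⊓ y)) λ j _ →
          reflexive (≡.cong (λ n → level n (x ∸ j) (y ∸ j) Φ) (ℕ.+-suc j k))))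

      -- With o = x + y, words have total o + 2k = T in units of p and length o + j = T - i - k. The
      -- sizes enter through equations so that they can be given in the theorem's own form.
      term-𝒜 : ∀ i j k x y {T M} → k ≡ i ℕ.+ j → T ≡ (x ℕ.+ k) ℕ.+ (y ℕ.+ k) → M ≡ T → ∀ Φ →
        term i j x y Φ ≈ sumOver (𝒜 p (T ∸ i ∸ k) M j) λ a →
          ((T ∸ 2 ℕ.* k) C x) × (r ^ i * s ^ j) * Φ a
      term-𝒜 i j k x y {T} ≡.refl ≡.refl ≡.refl Φ = begin
        weight x y i j * sumOver (words 0 o i j) Φ
          ≈⟨ *-congˡ (sumOver-↭ Φ (𝒜↭words o i j)) ⟨
        weight x y i j * sumOver (𝒜 p (o ℕ.+ j) (o ℕ.+ 2 ℕ.* k) j) Φ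
          ≈⟨ sumOver-scale (𝒜 p (o ℕ.+ j) (o ℕ.+ 2 ℕ.* k) j) _ Φ ⟨
        sumOver (𝒜 p (o ℕ.+ j) (o ℕ.+ 2 ℕ.* k) j) (λ a → (o C x) × (r ^ i * s ^ j) * Φ a)
          ≡⟨ ≡.cong₂ (λ N M → sumOver (𝒜 p N M j) (λ a → (o C x) × (r ^ i * s ^ j) * Φ a)) N≡ (≡.sym T≡) ⟩
        sumOver (𝒜 p (T ∸ i ∸ k) T j) (λ a → (o C x) × (r ^ i * s ^ j) * Φ a)
          ≡⟨ ≡.cong (λ n → sumOver (𝒜 p (T ∸ i ∸ k) T j) (λ a → (n C x) × (r ^ i * s ^ j) * Φ a)) o≡ ⟩
        sumOver (𝒜 p (T ∸ i ∸ k) T j) (λ a → ((T ∸ 2 ℕ.* k) C x) × (r ^ i * s ^ j) * Φ a) ∎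
        where
        o = x ℕ.+ y
        total-size : ∀ x y k → (x ℕ.+ k) ℕ.+ (y ℕ.+ k) ≡ x ℕ.+ y ℕ.+ 2 ℕ.* k
        total-size = solve-∀
        total-size′ : ∀ x y i j →
          (x ℕ.+ (i ℕ.+ j)) ℕ.+ (y ℕ.+ (i ℕ.+ j)) ≡ x ℕ.+ y ℕ.+ j ℕ.+ (i ℕ.+ j) ℕ.+ i
        total-size′ = solve-∀
        T≡ : T ≡ o ℕ.+ 2 ℕ.* k
        T≡ = total-size x y k
        o≡ : o ≡ T ∸ 2 ℕ.* k
        o≡ = ≡.sym (≡.trans (≡.cong (_∸ 2 ℕ.* k) T≡) (ℕ.m+n∸n≡m o (2 ℕ.* k)))
        N≡ : o ℕ.+ j ≡ T ∸ i ∸ k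
        N≡ = ≡.sym (≡.trans (≡.cong (λ n → n ∸ i ∸ k) (total-size′ x y i j))
          (≡.trans (≡.cong (_∸ k) (ℕ.m+n∸n≡m (o ℕ.+ j ℕ.+ k) i)) (ℕ.m+n∸n≡m (o ℕ.+ j) k)))

    -- T and M are the same number, kept apart because the theorem builds lengths from v + n and
    -- totals from n + v.
    powers : ∀ x y {T M} → T ≡ x ℕ.+ y → M ≡ T → ∀ Φ →
      ⟨ replicate x p * replicate y p ⟩ Φ ≈
      sumOver (0 ⋯ (x ⊓ y)) λ k → sumOver (antidiagonal k) λ (i , j) →
      sumOver (𝒜 p (T ∸ i ∸ k) M j) λ a → ((T ∸ 2 ℕ.* k) C (x ∸ k)) × (r ^ i * s ^ j) * Φ a
    powers x y {T} {M} T≡ M≡ Φ = begin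
      ⟨ replicate x p * replicate y p ⟩ Φ
        ≈⟨ power-diagonal x y Φ ⟩
      diagonal 0 x y Φ
        ≈⟨ diagonal-sum 0 x y Φ ⟩
      sum< (suc (x ⊓ y)) (λ k → level (k ℕ.+ 0) (x ∸ k) (y ∸ k) Φ)
        ≈⟨ sum<-cong (suc (x ⊓ y)) summand ⟩
      sum< (suc (x ⊓ y)) (λ k → sumOver (antidiagonal k) λ (i , j) →
        sumOver (𝒜 p (T ∸ i ∸ k) M j) λ a → ((T ∸ 2 ℕ.* k) C (x ∸ k)) × (r ^ i * s ^ j) * Φ a)
        ≡⟨ sumOver-applyUpTo (λ k → k) (suc (x ⊓ y)) _ ⟨
      _ ∎
      where
      summand : ∀ k → k ℕ.< suc (x ⊓ y) → level (k ℕ.+ 0) (x ∸ k) (y ∸ k) Φ ≈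
        sumOver (antidiagonal k) λ (i , j) →
        sumOver (𝒜 p (T ∸ i ∸ k) M j) λ a → ((T ∸ 2 ℕ.* k) C (x ∸ k)) × (r ^ i * s ^ j) * Φ a
      summand k k≤ = begin
        level (k ℕ.+ 0) (x ∸ k) (y ∸ k) Φ
          ≡⟨ ≡.cong (λ n → level n (x ∸ k) (y ∸ k) Φ) (ℕ.+-identityʳ k) ⟩
        level k (x ∸ k) (y ∸ k) Φ
          ≈⟨ sum<-cong (suc k) (λ i i≤k → term-𝒜 i (k ∸ i) k (x ∸ k) (y ∸ k)
               (≡.sym (ℕ.m+[n∸m]≡n (ℕ.s≤s⁻¹ i≤k)))
               (≡.trans T≡ (≡.sym (≡.cong₂ ℕ._+_ (ℕ.m∸n+n≡m k≤x) (ℕ.m∸n+n≡m k≤y)))) M≡ Φ) ⟩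
        antidiagonalSum k (λ i j →
          sumOver (𝒜 p (T ∸ i ∸ k) M j) λ a → ((T ∸ 2 ℕ.* k) C (x ∸ k)) × (r ^ i * s ^ j) * Φ a)
          ≡⟨ sumOver-antidiagonal k _ ⟨
        _ ∎
        where
        k≤x = ℕ.≤-trans (ℕ.s≤s⁻¹ k≤) (ℕ.m⊓n≤m x y)
        k≤y = ℕ.≤-trans (ℕ.s≤s⁻¹ k≤) (ℕ.m⊓n≤n x y)

    -- The place of the second large letter

    ⟨*⟩-linear : ∀ ws vs (F G K : List ℕ⁺ → Carrier) →
      ⟨ ws * vs ⟩ (λ a → F a + s * G a + r * K a) ≈
      ⟨ ws * vs ⟩ F + s * ⟨ ws * vs ⟩ G + r * ⟨ ws * vs ⟩ K
    ⟨*⟩-linear ws vs F G K = begin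
      ⟨ ws * vs ⟩ (λ a → F a + s * G a + r * K a)
        ≈⟨ ⟨*⟩-+ ws vs (λ a → F a + s * G a) (λ a → r * K a) ⟩
      ⟨ ws * vs ⟩ (λ a → F a + s * G a) + ⟨ ws * vs ⟩ (λ a → r * K a)
        ≈⟨ +-cong (⟨*⟩-+ ws vs F (λ a → s * G a)) (⟨*⟩-scale ws vs r K) ⟩
      ⟨ ws * vs ⟩ F + ⟨ ws * vs ⟩ (λ a → s * G a) + r * ⟨ ws * vs ⟩ K
        ≈⟨ +-congʳ (+-congˡ (⟨*⟩-scale ws vs s G)) ⟩
      ⟨ ws * vs ⟩ F + s * ⟨ ws * vs ⟩ G + r * ⟨ ws * vs ⟩ K ∎

    -- After l letters p, the letter u follows one more p, merges with it, or merges with it and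
    -- with the first letter of the product of the remaining powers.
    inserted : ℕ⁺ → (List ℕ⁺ → Carrier) → ℕ → List ℕ⁺ → Carrier
    inserted u Φ l a =
        Φ (replicate (suc l) p ++ u ∷ a)
      + s * Φ (replicate l p ++ u +⁺ p ∷ a)
      + r * onFirst (λ a₁ a′ → Φ (replicate l p ++ u +⁺ p +⁺ a₁ ∷ a′)) a

    -- Of the four terms of the product only the one starting with p alone leaves u unread.
    -- Unrolling just that term records how many p precede u; the last summand has none.
    insert : ∀ n v u Φ →
      ⟨ replicate n p * u ∷ replicate v p ⟩ Φ ≈
        sum< n (λ l → ⟨ replicate (n ∸ suc l) p * replicate v p ⟩ (inserted u Φ l))
      + ⟨ replicate n p * replicate v p ⟩ (λ a → Φ (u ∷ a))
    insert zero    v u Φ = sym (+-identityˡ _)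
    insert (suc n) v u Φ = begin
      _ ≈⟨ +-cong (+-cong (+-congʳ (insert n v u (λ a → Φ (p ∷ a))))
             (*-congˡ (⟨*⟩-cong pⁿ pᵛ λ a → reflexive (≡.cong (λ x → Φ (x ∷ a)) p+u≡u+p))))
             (*-congˡ (⟨*⟩-cong pⁿ pᵛ λ { [] → refl ; (a₁ ∷ a) →
               reflexive (≡.cong (λ x → Φ (x +⁺ a₁ ∷ a)) p+u≡u+p) })) ⟩
      _ ≈⟨ solve 7 (λ s r S a b c d → S :+ a :+ b :+ s :* c :+ r :* d := (a :+ s :* c :+ r :* d) :+ S :+ b)
             refl s r _ _ _ _ _ ⟩
      _ ≈⟨ +-congʳ (+-congʳ (⟨*⟩-linear pⁿ pᵛ (λ a → Φ (p ∷ u ∷ a)) (λ a → Φ (u +⁺ p ∷ a)) _)) ⟨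
      _ ∎
      where
      pⁿ = replicate n p
      pᵛ = replicate v p
      p+u≡u+p : p +⁺ u ≡ u +⁺ p
      p+u≡u+p = ℕ≥-≡ (ℕ.+-comm (value p) (value u))

    joined : ℕ⁺ → ℕ⁺ → (List ℕ⁺ → Carrier) → List ℕ⁺ → Carrier
    joined m u Φ a =
        Φ (m ∷ u ∷ a) + Φ (u ∷ m ∷ a) + s * Φ (m +⁺ u ∷ a)
      + r * onFirst (λ a₁ a′ → Φ (m +⁺ u +⁺ a₁ ∷ a′)) a

    powerSum : ℕ → ℕ → ℕ → ℕ → (List ℕ⁺ → Carrier) → Carrier
    powerSum x y T M Φ = sumOver (0 ⋯ (x ⊓ y)) λ k → sumOver (antidiagonal k) λ (i , j) →
      sumOver (𝒜 p (T ∸ i ∸ k) M j) λ a → ((T ∸ 2 ℕ.* k) C (x ∸ k)) × (r ^ i * s ^ j) * Φ a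

    -- A leading m leaves u to be inserted among the p, and a leading u leaves m. The cases where
    -- both are read at once, or one directly after the other, combine into `joined`.
    expansion : ∀ m u n v Φ →
      ⟨ m ∷ replicate n p * u ∷ replicate v p ⟩ Φ ≈
        sumOver (1 ⋯ n) (λ l → powerSum v (n ∸ l) (v ℕ.+ n ∸ l) (n ℕ.+ v ∸ l)
          (inserted u (λ a → Φ (m ∷ a)) (l ∸ 1)))
      + sumOver (1 ⋯ v) (λ l → powerSum n (v ∸ l) (v ℕ.+ n ∸ l) (n ℕ.+ v ∸ l)
          (inserted m (λ a → Φ (u ∷ a)) (l ∸ 1)))
      + powerSum n v (v ℕ.+ n) (n ℕ.+ v) (joined m u Φ)
    expansion m u n v Φ = begin
      ⟨ m ∷ pⁿ * u ∷ pᵛ ⟩ Φ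
        ≈⟨ +-congʳ (+-congʳ (+-cong (insert n v u (λ a → Φ (m ∷ a)))
             (trans (⟨*⟩-comm (m ∷ pⁿ) pᵛ (λ a → Φ (u ∷ a)))
               (trans (insert v n m (λ a → Φ (u ∷ a))) (+-congˡ (⟨*⟩-comm pᵛ pⁿ _)))))) ⟩
      _ ≈⟨ solve 8 (λ s r S S′ a b c d →
             (S :+ a) :+ (S′ :+ b) :+ s :* c :+ r :* d := S :+ S′ :+ ((a :+ b) :+ s :* c :+ r :* d))
             refl s r _ _ _ _ _ _ ⟩
      _ ≈⟨ +-congˡ (+-congʳ (+-congʳ (⟨*⟩-+ pⁿ pᵛ (λ a → Φ (m ∷ u ∷ a)) (λ a → Φ (u ∷ m ∷ a))))) ⟨
      _ ≈⟨ +-congˡ (⟨*⟩-linear pⁿ pᵛ (λ a → Φ (m ∷ u ∷ a) + Φ (u ∷ m ∷ a)) _ _) ⟨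
      _ ≈⟨ +-cong (+-cong first second) (powers n v (ℕ.+-comm v n) (ℕ.+-comm n v) (joined m u Φ)) ⟩
      _ ∎
      where
      pⁿ = replicate n p
      pᵛ = replicate v p
      first : sum< n (λ l → ⟨ replicate (n ∸ suc l) p * pᵛ ⟩ (inserted u (λ a → Φ (m ∷ a)) l)) ≈
        sumOver (1 ⋯ n) (λ l → powerSum v (n ∸ l) (v ℕ.+ n ∸ l) (n ℕ.+ v ∸ l)
          (inserted u (λ a → Φ (m ∷ a)) (l ∸ 1)))
      first = begin
        -- Commuting puts the power v first, which makes v - k the lower index of the binomial
        -- coefficient.
        _ ≈⟨ sum<-cong n (λ l l<n → trans (⟨*⟩-comm (replicate (n ∸ suc l) p) pᵛ _)
               (powers v (n ∸ suc l) (ℕ.+-∸-assoc v l<n)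
                 (≡.cong (_∸ suc l) (ℕ.+-comm n v)) (inserted u (λ a → Φ (m ∷ a)) l))) ⟩
        _ ≡⟨ sumOver-applyUpTo suc n _ ⟨
        _ ∎
      second : sum< v (λ l → ⟨ replicate (v ∸ suc l) p * pⁿ ⟩ (inserted m (λ a → Φ (u ∷ a)) l)) ≈
        sumOver (1 ⋯ v) (λ l → powerSum n (v ∸ l) (v ℕ.+ n ∸ l) (n ℕ.+ v ∸ l)
          (inserted m (λ a → Φ (u ∷ a)) (l ∸ 1)))
      second = begin
        _ ≈⟨ sum<-cong v (λ l l<v → trans (⟨*⟩-comm (replicate (v ∸ suc l) p) pⁿ _)
               (powers n (v ∸ suc l)
                 (≡.trans (≡.cong (_∸ suc l) (ℕ.+-comm v n)) (ℕ.+-∸-assoc n l<v))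
                 (≡.cong (_∸ suc l) (ℕ.+-comm n v)) (inserted m (λ a → Φ (u ∷ a)) l))) ⟩
        _ ≡⟨ sumOver-applyUpTo suc v _ ⟨
        _ ∎

-- Truncated multiple zeta values

1/-≃ : ∀ n .{{_ : ℕ.NonZero n}} → ℚ.toℚᵘ 1/[ n ] ℚᵘ.≃ (ℤ.+ 1 ℚᵘ./ n)
1/-≃ (suc n) = ℚ.toℚᵘ-fromℚᵘ (ℚᵘ.mkℚᵘ (ℤ.+ 1) n)

1/-* : ∀ m n .{{_ : ℕ.NonZero m}} .{{_ : ℕ.NonZero n}} .{{_ : ℕ.NonZero (m ℕ.* n)}} →
  1/[ m ℕ.* n ] ≡ 1/[ m ] ℚ.* 1/[ n ]
1/-* m@(suc _) n@(suc _) = ℚ.toℚᵘ-injective (begin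
  ℚ.toℚᵘ 1/[ m ℕ.* n ]                    ≈⟨ 1/-≃ (m ℕ.* n) ⟩
  (ℤ.+ 1 ℚᵘ./ m) ℚᵘ.* (ℤ.+ 1 ℚᵘ./ n)      ≈⟨ ℚᵘ.*-cong (1/-≃ m) (1/-≃ n) ⟨
  ℚ.toℚᵘ 1/[ m ] ℚᵘ.* ℚ.toℚᵘ 1/[ n ]      ≈⟨ ℚ.toℚᵘ-homo-* 1/[ m ] 1/[ n ] ⟨
  ℚ.toℚᵘ (1/[ m ] ℚ.* 1/[ n ])            ∎)
  where open ℚᵘ.≃-Reasoning

1/^-+ : ∀ m k l .{{_ : ℕ.NonZero m}} → 1/ m ^ (k ℕ.+ l) ≡ 1/ m ^ k ℚ.* 1/ m ^ l
1/^-+ m k l = ≡.trans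
  (ℚ./-cong {ℤ.+ 1} {m ℕ.^ (k ℕ.+ l)} {ℤ.+ 1} {m ℕ.^ k ℕ.* m ℕ.^ l} {{ℕ.m^n≢0 m (k ℕ.+ l)}}
    {{ℕ.m*n≢0 _ _ {{ℕ.m^n≢0 m k}} {{ℕ.m^n≢0 m l}}}} ≡.refl (ℕ.^-distribˡ-+-* m k l))
  (1/-* (m ℕ.^ k) (m ℕ.^ l) {{ℕ.m^n≢0 m k}} {{ℕ.m^n≢0 m l}} {{ℕ.m*n≢0 _ _ {{ℕ.m^n≢0 m k}} {{ℕ.m^n≢0 m l}}}})

infix 4 _≋[_]_
-- Under this relation `ℝ` embeds into `ℚ` as a ring, by x ↦ `seq x M`, so the ring laws are
-- inherited.
_≋[_]_ : ℝ → ℕ → ℝ → Set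
x ≋[ M ] y = seq x M ≡ seq y M

≋-isCommutativeRing : ∀ M → IsCommutativeRing _≋[ M ]_ _+ℝ_ _*ℝ_ -ℝ_ (fromℚ 0ℚ) (fromℚ 1ℚ)
≋-isCommutativeRing M = RingMonomorphism.isCommutativeRing
  {R₁ = record { _≈_ = _≋[ M ]_ ; _+_ = _+ℝ_ ; _*_ = _*ℝ_ ; -_ = -ℝ_ ; 0# = fromℚ 0ℚ ; 1# = fromℚ 1ℚ }}
  {R₂ = CommutativeRing.rawRing ℚ.+-*-commutativeRing} {⟦_⟧ = λ x → seq x M}
  (record
    { isRingHomomorphism = record
      { isSemiringHomomorphism = record
        { isNearSemiringHomomorphism = record
          { +-isMonoidHomomorphism = record
            { isMagmaHomomorphism = record
              { isRelHomomorphism = record { cong = λ eq → eq }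
              ; homo              = λ _ _ → ≡.refl
              }
            ; ε-homo = ≡.refl
            }
          ; *-homo = λ _ _ → ≡.refl
          }
        ; 1#-homo = ≡.refl
        }
      ; -‿homo = λ _ → ≡.refl
      }
    ; injective = λ eq → eq
    })
  ℚ.+-*-isCommutativeRing

total≡0⇒[] : ∀ a → total a ≡ 0 → a ≡ []
total≡0⇒[] []      _  = ≡.refl
total≡0⇒[] (x ∷ a) Σ≡0 = contradiction (ℕ.m+n≡0⇒m≡0 (value x) Σ≡0) (ℕ.>⇒≢ (≤value x))

open import Data.Nat.Base using (_+_; _*_)

-- From approximants to the interpolated values

s r : Poly
s = 1ₚ -ₚ 2 ×ₚ t
r = t ^ₚ 2 -ₚ t

-- Independent of M, so that at every M the same polynomials are compared and `truncated` unfolds to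
-- the wording of the theorem.
module Poly-sums (p : ℕ⁺) where

  powerSumₚ : ℕ → ℕ → ℕ → ℕ → (List ℕ⁺ → Poly) → Poly
  powerSumₚ x y T K F =
    ∑ (0 ⋯ (x ⊓ y)) λ k → ∑ (antidiagonal k) λ (i , j) → ∑ (𝒜 p (T ∸ i ∸ k) K j) λ a →
    ((T ∸ 2 * k) C (x ∸ k)) ×ₚ (r ^ₚ i *ₚ s ^ₚ j) *ₚ F a

  insertedₚ : ℕ≥ 2 → ℕ≥ 2 → Poly → ℕ → List ℕ⁺ → Poly
  insertedₚ m u d l a =
       ζᵗ (m , replicate l p ++ pos u ∷ a)
    +ₚ s *ₚ ζᵗ (m , replicate (l ∸ 1) p ++ pos u +⁺ p ∷ a)
    +ₚ (1ₚ -ₚ d) *ₚ r *ₚ split a (λ a₁ a′ → ζᵗ (m , replicate (l ∸ 1) p ++ pos u +⁺ p +⁺ a₁ ∷ a′))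

  joinedₚ : ℕ≥ 2 → ℕ≥ 2 → Poly → List ℕ⁺ → Poly
  joinedₚ m u d a =
       ζᵗ (m , pos u ∷ a) +ₚ ζᵗ (u , pos m ∷ a) +ₚ s *ₚ ζᵗ (m +⁺ u , a)
    +ₚ (1ₚ -ₚ d) *ₚ r *ₚ split a (λ a₁ a′ → ζᵗ (m +⁺ u +⁺ a₁ , a′))

module Approximation (M : ℕ) where
  open PolynomialRing ℝ-rawRing _≋[ M ]_ (≋-isCommutativeRing M) using (coefficientwise; coeff-≈)

  A : CommutativeRing 0ℓ 0ℓ
  A = PolynomialRing.commutativeRing ℝ-rawRing _≋[ M ]_ (≋-isCommutativeRing M)

  open CommutativeRing A
    using (_≈_; refl; sym; trans; reflexive; setoid; +-cong; *-cong; *-congˡ; *-identityˡ; zeroʳ)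
  open import Relation.Binary.Reasoning.Setoid setoid
  open import Algebra.Properties.Monoid.Mult (CommutativeRing.+-monoid A) using (_×_; ×-congʳ)
  open import Algebra.Properties.Semiring.Exp (CommutativeRing.semiring A) using (_^_)
  open HarmonicProduct A

  -- `ℝ[t]` and `A` carry different equalities, so multiples and powers formed over them are
  -- identified by induction rather than by unfolding.
  ×ₚ≡× : ∀ n f → n ×ₚ f ≡ n × f
  ×ₚ≡× zero    f = ≡.refl
  ×ₚ≡× (suc n) f = ≡.cong (f +ₚ_) (×ₚ≡× n f)

  ^ₚ≡^ : ∀ f n → f ^ₚ n ≡ f ^ n
  ^ₚ≡^ f zero    = ≡.refl
  ^ₚ≡^ f (suc n) = ≡.cong (f *ₚ_) (^ₚ≡^ f n)

  s+2t≈1 : s +ₚ (t +ₚ t) ≈ 1ₚ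
  s+2t≈1 = 1-2x+2x≈1 t

  r+t≈t² : r +ₚ t ≈ t *ₚ t
  r+t≈t² = x²-x+x≈x² t

  -- The variables of `Z` start at 0 and those of ζ at 1, hence `suc N`.
  w : ℕ → ℕ → Poly
  w N k = const (fromℚ (1/ suc N ^ k))

  const-cong : ∀ {x y} → x ≋[ M ] y → const x ≈ const y
  const-cong x≋y = coefficientwise λ { zero → x≋y ; (suc i) → ≡.refl }

  const-* : ∀ x y → const (x *ℝ y) ≈ const x *ₚ const y
  const-* x y = coefficientwise λ { zero → ≡.sym (ℚ.+-identityʳ (seq x M ℚ.* seq y M)) ; (suc i) → ≡.refl }

  w-+ : ∀ N k l → w N (k + l) ≈ w N k *ₚ w N l
  w-+ N k l = trans (const-cong (1/^-+ (suc N) k l))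
    (const-* (fromℚ (1/ suc N ^ k)) (fromℚ (1/ suc N ^ l)))

  open TruncatedZeta t s r s+2t≈1 r+t≈t² w w-+

  const-ζ≤ : ∀ N ks → const (fromℚ (ζ≤ N ks)) ≈ Y N ks
  const-ζ≤ N       []       = refl
  -- The constant 0 is a list of length one and `0ₚ` the empty list.
  const-ζ≤ zero    (k ∷ ks) = coefficientwise λ { zero → ≡.refl ; (suc i) → ≡.refl }
  const-ζ≤ (suc N) (k ∷ ks) = trans
    (const-cong {y = fromℚ (ζ≤ N (k ∷ ks)) +ℝ fromℚ (1/ suc N ^ value k) *ℝ fromℚ (ζ≤ N ks)} ≡.refl)
    (+-cong (const-ζ≤ N (k ∷ ks)) (trans (const-* (fromℚ (1/ suc N ^ value k)) (fromℚ (ζ≤ N ks)))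
      (*-congˡ {w N (value k)} (const-ζ≤ N ks))))

  -- The index of the approximant is also the truncation bound: `seq (ζ q) M` is by definition the
  -- sum over m₁ ≤ M.
  ζᵗ≈Z : ∀ m ks → ζᵗ (m , ks) ≈ Z M (pos m ∷ ks)
  ζᵗ≈Z m ks = begin
    ζᵗ (m , ks)
      ≈⟨ sumOver-cong (merges m ks) (λ q → *-cong
           (reflexive (^ₚ≡^ t (suc (length ks) ∸ dep q)))
           (trans (const-cong ≡.refl) (const-ζ≤ M (pos (proj₁ q) ∷ proj₂ q)))) ⟩
    merged (Y∷ M) m ks ≈⟨ merged-Y M m ks ⟩
    Z∷ M (value m) ks  ≈⟨ Z≈Z∷ M (pos m) ks ⟨
    Z M (pos m ∷ ks)   ∎

  module _ (p : ℕ⁺) where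
    open Product s r using (⟨_*_⟩)
    open Power s r p
    open Poly-sums p

    -- Either the factor 1 - d is 1, or the total is 0; then the tuple is empty and both sides
    -- vanish.
    last-summand : ∀ N K j d {f g : ℕ⁺ → List ℕ⁺ → Poly} →
      K ≡ 0 ⊎ d ≈ 0ₚ → (∀ a₁ a → f a₁ a ≈ g a₁ a) → ∀ {a} → a ∈ 𝒜 p N K j →
      (1ₚ -ₚ d) *ₚ r *ₚ split a f ≈ r *ₚ onFirst g a
    last-summand N K j d {f} {g} (inj₁ ≡.refl) f≈g {a} a∈
      with total≡0⇒[] a (proj₁ (proj₂ (proj₂ (Equivalence.to (∈𝒜 p N 0 j a) a∈))))
    ... | ≡.refl = trans (zeroʳ ((1ₚ -ₚ d) *ₚ r)) (sym (zeroʳ r))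
    last-summand N K j d {f} {g} (inj₂ d≈0) f≈g {a} a∈ = *-cong
      (x≈0⇒[1-x]y≈y d r d≈0) (split≈onFirst a)
      where
      split≈onFirst : ∀ a → split a f ≈ onFirst g a
      split≈onFirst []       = refl
      split≈onFirst (a₁ ∷ a) = f≈g a₁ a

    -- The brackets are compared on members of `𝒜` only, as `last-summand` relies on their total.
    powerSum-cong : ∀ x y T K {F : List ℕ⁺ → Poly} {Φ} →
      (∀ N j {a} → a ∈ 𝒜 p N K j → F a ≈ Φ a) →
      powerSumₚ x y T K F ≈ powerSum x y T K Φ
    powerSum-cong x y T K F≈Φ =
      sumOver-cong (0 ⋯ (x ⊓ y)) λ k → sumOver-cong (antidiagonal k) λ (i , j) →
      sumOver-cong-All (All.tabulate λ a∈ → *-cong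
        (trans (reflexive (×ₚ≡× ((T ∸ 2 * k) C (x ∸ k)) (r ^ₚ i *ₚ s ^ₚ j)))
          (×-congʳ ((T ∸ 2 * k) C (x ∸ k)) (reflexive (≡.cong₂ _*ₚ_ (^ₚ≡^ r i) (^ₚ≡^ s j)))))
        (F≈Φ (T ∸ i ∸ k) j a∈))

    δ-≢ : ∀ {i j} → i ≢ j → δ i j ≡ 0ₚ
    δ-≢ {i} {j} i≢j with i ℕ.≡ᵇ j in eq
    ... | false = ≡.refl
    ... | true  = contradiction (ℕ.≡ᵇ⇒≡ i j (≡.subst T (≡.sym eq) tt)) i≢j

    -- The Kronecker product differs from 0 only for x = 0 and y = l, and then x + y - l is 0.
    δδ : ∀ x y l {K} → l ℕ.≤ y → K ≡ x + y ∸ l → K ≡ 0 ⊎ δ x 0 *ₚ δ y l ≈ 0ₚ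
    δδ (suc x) y l l≤y K≡ = inj₂ refl
    δδ zero    y l l≤y K≡ with y ℕ.≟ l
    ... | yes ≡.refl = inj₁ (≡.trans K≡ (ℕ.n∸n≡0 y))
    ... | no  y≢l    = inj₂ (trans (*-identityˡ (δ y l)) (reflexive (δ-≢ y≢l)))

    inserted-ζᵗ : ∀ (m u : ℕ≥ 2) x y l {K} → 1 ℕ.≤ l → l ℕ.≤ y → K ≡ x + y ∸ l →
      ∀ N j {a} → a ∈ 𝒜 p N K j →
      insertedₚ m u (δ x 0 *ₚ δ y l) l a ≈ inserted (pos u) (λ a → Z M (pos m ∷ a)) (l ∸ 1) a
    inserted-ζᵗ m u x y (suc l) 1≤l l≤y K≡ N j {a} a∈ = +-cong
      (+-cong (ζᵗ≈Z m (replicate (suc l) p ++ pos u ∷ a))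
        (*-congˡ {s} (ζᵗ≈Z m (replicate l p ++ pos u +⁺ p ∷ a))))
      (last-summand N _ j (δ x 0 *ₚ δ y (suc l)) (δδ x y (suc l) l≤y K≡)
        (λ a₁ a′ → ζᵗ≈Z m (replicate l p ++ pos u +⁺ p +⁺ a₁ ∷ a′)) a∈)

    joined-ζᵗ : ∀ (m u : ℕ≥ 2) n v N j {a} → a ∈ 𝒜 p N (n + v) j →
      joinedₚ m u (δ n 0 *ₚ δ v 0) a ≈ joined (pos m) (pos u) (Z M) a
    joined-ζᵗ m u n v N j {a} a∈ = +-cong
      (+-cong (+-cong (ζᵗ≈Z m (pos u ∷ a)) (ζᵗ≈Z u (pos m ∷ a))) (*-congˡ {s} (ζᵗ≈Z (m +⁺ u) a)))
      (last-summand N (n + v) j (δ n 0 *ₚ δ v 0) (δδ n v 0 ℕ.z≤n ≡.refl)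
        (λ a₁ a′ → ζᵗ≈Z (m +⁺ u +⁺ a₁) a′) a∈)

    1⋯-bounds : ∀ n → All (λ l → 1 ℕ.≤ l ∧ l ℕ.≤ n) (1 ⋯ n)
    1⋯-bounds n = All.applyUpTo⁺₁ suc n λ i<n → ℕ.s≤s ℕ.z≤n , i<n

    truncated : ∀ m u n v → ζᵗ (m , replicate n p) *ₚ ζᵗ (u , replicate v p) ≈
         (∑ (1 ⋯ n) λ l → powerSumₚ v (n ∸ l) (v + n ∸ l) (n + v ∸ l)
           (insertedₚ m u (δ v 0 *ₚ δ n l) l))
      +ₚ (∑ (1 ⋯ v) λ l → powerSumₚ n (v ∸ l) (v + n ∸ l) (n + v ∸ l)
           (insertedₚ u m (δ n 0 *ₚ δ v l) l))
      +ₚ powerSumₚ n v (v + n) (n + v) (joinedₚ m u (δ n 0 *ₚ δ v 0))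
    truncated m u n v = begin
      ζᵗ (m , replicate n p) *ₚ ζᵗ (u , replicate v p)
        ≈⟨ *-cong (ζᵗ≈Z m (replicate n p)) (ζᵗ≈Z u (replicate v p)) ⟩
      Z M (pos m ∷ replicate n p) *ₚ Z M (pos u ∷ replicate v p)
        ≈⟨ Z-* M (pos m ∷ replicate n p) (pos u ∷ replicate v p) ⟨
      ⟨ pos m ∷ replicate n p * pos u ∷ replicate v p ⟩ (Z M)
        ≈⟨ expansion (pos m) (pos u) n v (Z M) ⟩
      _ ≈⟨ +-cong (+-cong
             (sumOver-cong-All (All.map (λ {l} (1≤l , l≤n) → powerSum-cong v (n ∸ l) (v + n ∸ l) (n + v ∸ l)
               (inserted-ζᵗ m u v n l 1≤l l≤n (≡.cong (_∸ l) (ℕ.+-comm n v)))) (1⋯-bounds n)))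
             (sumOver-cong-All (All.map (λ {l} (1≤l , l≤v) → powerSum-cong n (v ∸ l) (v + n ∸ l) (n + v ∸ l)
               (inserted-ζᵗ u m n v l 1≤l l≤v ≡.refl)) (1⋯-bounds v))))
             (powerSum-cong n v (v + n) (n + v) (joined-ζᵗ m u n v)) ⟨
      _ ∎

-- The approximants agree at every M, so index 0 serves for every ε.
≋⇒≈ₚ : ∀ {f g} → (∀ M → CommutativeRing._≈_ (Approximation.A M) f g) → f ≈ₚ g
≋⇒≈ₚ {f} {g} f≋g i ε 0<ε = 0 , λ M _ → ≡.subst (λ d → ℚ.∣ d ∣ ℚ.< ε)
  (≡.sym (≡.trans (≡.cong (ℚ._- gᵢ M) (coeff-≈ (f≋g M) i)) (ℚ.+-inverseʳ (gᵢ M)))) 0<ε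
  where
  open PolynomialRing using (coeff-≈)
  gᵢ : ℕ → ℚ.ℚ
  gᵢ = seq (Polynomial.coeff ℝ-rawRing g i)

theorem3 : (m u : ℕ≥ 2) (p : ℕ⁺) (n v : ℕ) →
    ζᵗ (m , replicate n p) *ₚ ζᵗ (u , replicate v p)
    ≈ₚ
    (∑ (1 ⋯ n) λ l →
    ∑ (0 ⋯ (v ⊓ (n ∸ l))) λ k →
    ∑ (antidiagonal k) λ (i , j) →
    ∑ (𝒜 p (v + n ∸ l ∸ i ∸ k) (n + v ∸ l) j) λ a →
    ((v + n ∸ l ∸ 2 * k) C (v ∸ k)) ×ₚ ((t ^ₚ 2 -ₚ t) ^ₚ i *ₚ (1ₚ -ₚ 2 ×ₚ t) ^ₚ j)
    *ₚ ( ζᵗ (m , replicate l p ++ pos u ∷ a)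
    +ₚ (1ₚ -ₚ 2 ×ₚ t) *ₚ ζᵗ (m , replicate (l ∸ 1) p ++ pos u +⁺ p ∷ a)
    +ₚ (1ₚ -ₚ δ v 0 *ₚ δ n l) *ₚ (t ^ₚ 2 -ₚ t)
    *ₚ split a (λ a₁ a′ → ζᵗ (m , replicate (l ∸ 1) p ++ pos u +⁺ p +⁺ a₁ ∷ a′))))
    +ₚ
    (∑ (1 ⋯ v) λ l →
    ∑ (0 ⋯ (n ⊓ (v ∸ l))) λ k →
    ∑ (antidiagonal k) λ (i , j) →
    ∑ (𝒜 p (v + n ∸ l ∸ i ∸ k) (n + v ∸ l) j) λ a →
    ((v + n ∸ l ∸ 2 * k) C (n ∸ k)) ×ₚ ((t ^ₚ 2 -ₚ t) ^ₚ i *ₚ (1ₚ -ₚ 2 ×ₚ t) ^ₚ j)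
    *ₚ ( ζᵗ (u , replicate l p ++ pos m ∷ a)
    +ₚ (1ₚ -ₚ 2 ×ₚ t) *ₚ ζᵗ (u , replicate (l ∸ 1) p ++ pos m +⁺ p ∷ a)
    +ₚ (1ₚ -ₚ δ n 0 *ₚ δ v l) *ₚ (t ^ₚ 2 -ₚ t)
    *ₚ split a (λ a₁ a′ → ζᵗ (u , replicate (l ∸ 1) p ++ pos m +⁺ p +⁺ a₁ ∷ a′))))
    +ₚ
    (∑ (0 ⋯ (n ⊓ v)) λ k →
    ∑ (antidiagonal k) λ (i , j) →
    ∑ (𝒜 p (v + n ∸ i ∸ k) (n + v) j) λ a →
    ((v + n ∸ 2 * k) C (n ∸ k)) ×ₚ ((t ^ₚ 2 -ₚ t) ^ₚ i *ₚ (1ₚ -ₚ 2 ×ₚ t) ^ₚ j)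
    *ₚ ( ζᵗ (m , pos u ∷ a)
    +ₚ ζᵗ (u , pos m ∷ a)
    +ₚ (1ₚ -ₚ 2 ×ₚ t) *ₚ ζᵗ (m +⁺ u , a)
    +ₚ (1ₚ -ₚ δ n 0 *ₚ δ v 0) *ₚ (t ^ₚ 2 -ₚ t)
    *ₚ split a (λ a₁ a′ → ζᵗ (m +⁺ u +⁺ a₁ , a′))))
theorem3 m u p n v = ≋⇒≈ₚ λ M → Approximation.truncated M p m u n v
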